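{- Every totally positive integer solution $(a_1,\dots,a_n)$ of the equation $R_n(a_1,\dots,a_n)=0$ corresponds to a centrally symmetric triangulation of a $2n$-gon; that is, there is a centrally symmetric triangulation of the (regular) $2n$-gon, with vertices labeled cyclically $1,\dots,2n$, such that for each $1\le i\le n$ the number of triangles adjacent to vertex $i$, and likewise the number of triangles adjacent to vertex $i+n$, equals $a_i$.
   Context: Here $n$ is a positive integer. The continuant $K_m(a_1,\dots,a_m)$ is the determinant of the $m\times m$ tridiagonal matrix with diagonal entries $a_1,\dots,a_m$, all entries immediately above and below the diagonal equal to $1$, and all other entries $0$; by convention $K_0=1$ and $K_{ -1}=0$. The rotundus is $R_n(a_1,\dots,a_n):=K_n(a_1,\dots,a_n)-K_{n-2}(a_2,\dots,a_{n-1})$. Given $(a_1,\dots,a_n)$, extend it to an $n$-periodic sequence $(a_i)_{i\in\mathbb{Z}}$. A solution of $R_n(a_1,\dots,a_n)=0$ is called totally positive if $K_{j-i+1}(a_i,a_{i+1},\dots,a_j)>0$ for all integers $i\le j$ with $j-i\le n$. A triangulation of a polygon is a decomposition into triangles by pairwise non-crossing diagonals joining vertices of the polygon. A triangulation of the regular $2n$-gon is centrally symmetric if it is invariant under rotation by $180^\circ$ about the center. A triangle of the triangulation is adjacent to a vertex of the polygon if that vertex is one of its corners. -}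

module Defs where

open import Level using (0ℓ; _⊔_) renaming (suc to lsuc)
open import Data.Bool.Base using (if_then_else_)
open import Data.Fin.Base as Fin using (Fin; zero; suc; toℕ; fromℕ<; inject₁; punchIn; splitAt; join)
open import Data.Fin.Properties as Fin using ()
open import Data.Fin.Subset using (Subset; _∈_; ⊤; ∣_∣)
open import Data.Integer.Base as ℤ using (ℤ; +_; 0ℤ; 1ℤ; -1ℤ)
open import Data.Integer.DivMod using (_%ℕ_; n%ℕd<d)
open import Data.Integer.Properties using (+-0-commutativeMonoid)
open import Data.List.Base using (length)
open import Data.List.Membership.Propositional using () renaming (_∈_ to _∈ₗ_)
open import Data.List.Relation.Unary.Unique.Propositional using (Unique)
open import Data.Nat.Base as ℕ using (ℕ; zero; suc; NonZero)
open import Data.Nat.Properties as ℕ using ()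
open import Data.Product.Base using (∃-syntax; _×_)
open import Data.Sum.Base using (_⊎_; swap)
open import Data.Vec.Functional using (Vector)
open import Algebra.Properties.CommutativeMonoid.Sum +-0-commutativeMonoid using (sum)
open import Function.Base using (_∘_)
open import Function.Bundles using (_⇔_)
open import Relation.Binary.Core using (Rel)
open import Relation.Binary.Definitions using (Decidable; Symmetric)
open import Relation.Binary.PropositionalEquality.Core using (_≡_; _≢_)
open import Relation.Nullary.Decidable.Core using (does)
open import Relation.Nullary.Negation.Core using (¬_)

Matrix : ℕ → Set
Matrix m = Fin m → Fin m → ℤ

-- Laplace expansion along the first row.
det : ∀ {m} → Matrix m → ℤ
det {zero}  A = 1ℤ
det {suc m} A = sum λ j →
  (-1ℤ ℤ.^ toℕ j) ℤ.* A zero j ℤ.* det (λ r c → A (suc r) (punchIn j c))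

tridiagonal : ∀ {m} → Vector ℤ m → Matrix m
tridiagonal a i j =
  if does (i Fin.≟ j) then a i
  else if does (ℕ.∣ toℕ i - toℕ j ∣ ℕ.≟ 1) then 1ℤ
  else 0ℤ

K : ∀ {m} → Vector ℤ m → ℤ
K a = det (tridiagonal a)

-- For n = 1 the subtracted continuant is K₋₁ = 0.
R : ∀ {n} .{{_ : NonZero n}} → Vector ℤ n → ℤ
R {suc zero}    a = K a ℤ.- 0ℤ
R {suc (suc n)} a = K a ℤ.- K {n} (λ i → a (suc (inject₁ i)))

-- Indices are 0-based: the entry written a₁ sits at positions ≡ 0 (mod n).
periodic : ∀ {n} .{{_ : NonZero n}} → Vector ℤ n → ℤ → ℤ
periodic {n} a i = a (fromℕ< (n%ℕd<d i n))

-- The entries at positions i, i+1, …, j; used only for i ≤ j.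
segment : (ℤ → ℤ) → (i j : ℤ) → Vector ℤ (suc ℤ.∣ j ℤ.- i ∣)
segment s i j k = s (i ℤ.+ + toℕ k)

TotallyPositive : ∀ {n} .{{_ : NonZero n}} → Vector ℤ n → Set
TotallyPositive {n} a =
  ∀ (i j : ℤ) → i ℤ.≤ j → j ℤ.- i ℤ.≤ + n → 0ℤ ℤ.< K (segment (periodic a) i j)

-- The vertices of the N-gon are Fin N in cyclic order.  Between x z y holds
-- when z is met strictly before y on going round from x in increasing order.
Between : ∀ {N} → Fin N → Fin N → Fin N → Set
Between x z y =
    (x Fin.< z × z Fin.< y)
  ⊎ (z Fin.< y × y Fin.< x)
  ⊎ (y Fin.< x × x Fin.< z)

-- y follows x among the vertices in S.
Next : ∀ {N} → Subset N → Rel (Fin N) 0ℓ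
Next S x y = x ∈ S × y ∈ S × x ≢ y × (∀ z → z ∈ S → ¬ Between x z y)

-- Sides of the convex polygon spanned by S; the whole N-gon is S = ⊤.
Side : ∀ {N} → Subset N → Rel (Fin N) 0ℓ
Side S x y = Next S x y ⊎ Next S y x

Diagonal : ∀ {N} → Rel (Fin N) 0ℓ
Diagonal x y = x ≢ y × ¬ Side ⊤ x y

-- Chords {x,y} and {u,v} meeting in the interior, with u and v on opposite
-- sides of {x,y}; below, symmetry of the relation covers u and v exchanged.
Cross : ∀ {N} → (x y u v : Fin N) → Set
Cross x y u v = Between x u y × Between y v x

-- The pieces into which the chords D cut the N-gon: subpolygons bounded by
-- sides of the N-gon and chords of D, with no chord of D in their interior.
record IsRegion {N} (D : Rel (Fin N) 0ℓ) (S : Subset N) : Set where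
  field
    polygon   : 3 ℕ.≤ ∣ S ∣
    boundary  : ∀ {x y} → Side S x y → Side ⊤ x y ⊎ D x y
    undivided : ∀ {x y} → x ∈ S → y ∈ S → D x y → Side S x y

record Triangulation (N : ℕ) : Set (lsuc 0ℓ) where
  field
    D           : Rel (Fin N) 0ℓ
    D?          : Decidable D
    symmetric   : Symmetric D
    diagonal    : ∀ {x y} → D x y → Diagonal x y
    nonCrossing : ∀ {x y u v} → D x y → D u v → ¬ Cross x y u v
    triangular  : ∀ {S} → IsRegion D S → ∣ S ∣ ≡ 3

-- Rotation by 180°, i.e. i ↦ i + n mod 2n.
antipode : ∀ {n} → Fin (n ℕ.+ n) → Fin (n ℕ.+ n)
antipode {n} = join n n ∘ swap ∘ splitAt n

CentrallySymmetric : ∀ {n} → Triangulation (n ℕ.+ n) → Set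
CentrallySymmetric {n} 𝒯 = ∀ x y → D x y ⇔ D (antipode {n} x) (antipode {n} y)
  where open Triangulation 𝒯

-- Exactly m elements satisfy P.
HasCardinality : ∀ {a p} {A : Set a} → (A → Set p) → ℕ → Set (a ⊔ p)
HasCardinality {A = A} P m =
  ∃[ xs ] Unique xs × (∀ (x : A) → x ∈ₗ xs ⇔ P x) × length xs ≡ m

-- By the field `triangular`, every region is a triangle.
AdjacentTriangle : ∀ {N} → Triangulation N → Fin N → Subset N → Set
AdjacentTriangle 𝒯 v S = IsRegion (Triangulation.D 𝒯) S × v ∈ S

TrianglesAt : ∀ {N} → Triangulation N → Fin N → ℤ → Set
TrianglesAt 𝒯 v c = ∃[ m ] HasCardinality (AdjacentTriangle 𝒯 v) m × c ≡ + m

{-# OPTIONS --safe #-}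
module Submission where

-- Vertex i of the 2n-gon carries a vector wᵢ of ℤ², where wᵢ₋₁ + wᵢ₊₁ = aᵢ wᵢ.
-- The minors det(wᵢ, wⱼ) are continuants, R = 0 says that the shift by n has
-- trace 0, so that wᵢ₊₂ₙ = − wᵢ, and total positivity makes the minors positive
-- for i < j < i + 2n.  The diagonals of the triangulation are the non-adjacent
-- pairs with |det(wᵢ, wⱼ)| = 1.  Two of them cannot cross because, by the
-- Plücker relation, the product of two crossing minors is at least 2, and the
-- symmetry under rotation by n is immediate.  A discrete intermediate value argument finds a
-- triangle on each side of a diagonal, hence all regions are triangles.  Along
-- the neighbours u of v, the minor det(wᵥ₊₁, wᵤ) grows by exactly 1 at each
-- step, from 0 at u = v + 1 to aᵥ at u = v − 1, so there are aᵥ triangles at v.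

open import Defs
open import Data.Fin.Base as Fin using (Fin; zero; suc; toℕ; fromℕ<; inject₁; punchIn; splitAt; join; _↑ˡ_; _↑ʳ_)
open import Data.Fin.Properties as Fin
  using (toℕ-injective; toℕ<n; toℕ-fromℕ<; toℕ-↑ˡ; toℕ-↑ʳ; toℕ-inject₁; join-splitAt)
open import Data.Fin.Subset using (Subset; inside; outside; _∈_; _∉_; ⁅_⁆; _∪_; ⊤; ∣_∣)
open import Data.Fin.Subset.Properties
open import Data.Integer.Base as ℤ using (ℤ; 0ℤ; 1ℤ; -1ℤ; +_; -_; _-_)
open import Data.Integer.DivMod using (n%ℕd<d)
open import Data.Integer.Properties as ℤ using ()
open import Data.Integer.Tactic.RingSolver using (solve-∀)
open import Data.List.Base using ([]; _∷_)
open import Data.List.Membership.Propositional using () renaming (_∈_ to _∈ₗ_)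
open import Data.List.Relation.Unary.All as All using ()
open import Data.List.Relation.Unary.AllPairs using ([]; _∷_)
open import Data.List.Relation.Unary.Any using (here; there)
open import Data.Nat.Base using (ℕ; zero; suc; NonZero; _+_; _*_; _≤_; _<_; z≤n; s≤s; z<s)
open import Data.Nat.DivMod using (_/_; _%_; m%n<n; m<n⇒m%n≡m; [m+n]%n≡m%n; [m+kn]%n≡m%n; m≡m%n+[m/n]*n)
open import Data.Nat.Properties
open import Data.Product.Base using (Σ-syntax; ∃-syntax; _×_; _,_)
open import Data.Sum.Base using (_⊎_; inj₁; inj₂; swap)
open import Data.Vec.Base using ([]; _∷_)
open import Data.Vec.Functional using (Vector; tail)
open import Algebra.Properties.CommutativeMonoid.Sum ℤ.+-0-commutativeMonoid
  using (sum; sum-cong-≗; sum-replicate-zero)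
open import Function.Base using (_∘_)
open import Function.Bundles using (_⇔_; mk⇔; Equivalence)
open import Relation.Binary.Core using (Rel)
open import Relation.Binary.Definitions using (tri<; tri≈; tri>)
open import Relation.Binary.PropositionalEquality
open import Relation.Nullary.Decidable.Core using (Dec; yes; no; _×-dec_; _⊎-dec_; _→-dec_; ¬?)
open import Relation.Nullary.Negation.Core using (¬_; contradiction)
open import Relation.Unary using () renaming (Decidable to Decidable₁)

-- Continuants as determinants

sum-zero : ∀ {m} (f : Vector ℤ m) → (∀ j → f j ≡ 0ℤ) → sum f ≡ 0ℤ
sum-zero {m} f f≗0 = trans (sum-cong-≗ f≗0) (sum-replicate-zero m)

minor : ∀ {m} → Matrix (suc m) → Fin (suc m) → Matrix m
minor A j r c = A (suc r) (punchIn j c)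

-- The expansion runs along the first row, so the zero column is not seen at once: the first term
-- has a zero entry, and every other minor still contains the zero column, which calls for induction
-- on the size.
det-zeroColumn : ∀ {m} (A : Matrix (suc m)) → (∀ i → A i zero ≡ 0ℤ) → det A ≡ 0ℤ
det-zeroColumn A A₀≗0 = sum-zero _ (vanish A A₀≗0)
  where
  vanish : ∀ {m} (A : Matrix (suc m)) → (∀ i → A i zero ≡ 0ℤ) → ∀ j →
    -1ℤ ℤ.^ toℕ j ℤ.* A zero j ℤ.* det (minor A j) ≡ 0ℤ
  vanish A A₀≗0 zero rewrite A₀≗0 zero = refl
  vanish {suc m} A A₀≗0 (suc j) =
    trans (cong (-1ℤ ℤ.^ toℕ (suc j) ℤ.* A zero (suc j) ℤ.*_)
                (det-zeroColumn (minor A (suc j)) (A₀≗0 ∘ suc)))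
          (ℤ.*-zeroʳ (-1ℤ ℤ.^ toℕ (suc j) ℤ.* A zero (suc j)))

-- Without row 0 and column 1, the first column is (1, 0, 0, ...). Expansion along the first row
-- therefore leaves one term: every other minor keeps this column without its 1.
det-minor₁ : ∀ {m} (a : Vector ℤ (suc (suc m))) →
  det (minor (tridiagonal a) (suc zero)) ≡ K (tail (tail a))
det-minor₁ {m} a = trans
  (cong (λ t → 1ℤ ℤ.* 1ℤ ℤ.* K (tail (tail a)) ℤ.+ t) (sum-zero _ (vanish a)))
  (unit (K (tail (tail a))))
  where
  unit : ∀ z → 1ℤ ℤ.* 1ℤ ℤ.* z ℤ.+ 0ℤ ≡ z
  unit = solve-∀
  vanish : ∀ {m} (a : Vector ℤ (suc (suc m))) (j : Fin m) →
    -1ℤ ℤ.^ toℕ (suc j) ℤ.* tridiagonal a (suc zero) (suc (suc j)) ℤ.*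
    det (minor (minor (tridiagonal a) (suc zero)) (suc j)) ≡ 0ℤ
  vanish {suc m} a j = trans
    (cong (-1ℤ ℤ.^ toℕ (suc j) ℤ.* tridiagonal a (suc zero) (suc (suc j)) ℤ.*_)
          (det-zeroColumn (minor (minor (tridiagonal a) (suc zero)) (suc j)) λ i → refl))
    (ℤ.*-zeroʳ (-1ℤ ℤ.^ toℕ (suc j) ℤ.* tridiagonal a (suc zero) (suc (suc j))))

-- Only the first two entries of the first row are nonzero; their minors are `K (tail a)` and
-- `det-minor₁`.
K-recurrence : ∀ {m} (a : Vector ℤ (suc (suc m))) →
  K a ≡ a zero ℤ.* K (tail a) - K (tail (tail a))
K-recurrence {m} a = trans
  (cong₂ (λ u v → 1ℤ ℤ.* a zero ℤ.* K (tail a) ℤ.+ (-1ℤ ℤ.* 1ℤ ℤ.* u ℤ.+ v))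
     (det-minor₁ a)
     (sum-zero _ λ j → cong (ℤ._* det (minor (tridiagonal a) (suc (suc j))))
                            (ℤ.*-zeroʳ (-1ℤ ℤ.^ toℕ (suc (suc j))))))
  (arith (a zero) (K (tail a)) (K (tail (tail a))))
  where
  arith : ∀ x y z → 1ℤ ℤ.* x ℤ.* y ℤ.+ (-1ℤ ℤ.* 1ℤ ℤ.* z ℤ.+ 0ℤ) ≡ x ℤ.* y - z
  arith = solve-∀

-- Cyclic order on the vertices

module _ {P : ℕ → Set} (P? : Decidable₁ P) where

  least-above : ∀ {a b} → a < b → P b →
    ∃[ w ] a < w × w ≤ b × P w × (∀ t → a < t → t < w → ¬ P t)
  least-above {a} a<b Pb with m≤n⇒∃[o]m+o≡n a<b
  ... | d , refl = search d Pb
    where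
    search : ∀ d {a} → P (suc a + d) →
      ∃[ w ] a < w × w ≤ suc a + d × P w × (∀ t → a < t → t < w → ¬ P t)
    search d {a} Pb with P? (suc a)
    ... | yes Psa = suc a , ≤-refl , m≤m+n (suc a) d , Psa ,
      λ t a<t t<sa _ → <-irrefl refl (<-≤-trans a<t (≤-pred t<sa))
    search zero {a} Pb | no ¬Psa = contradiction (subst P (+-identityʳ (suc a)) Pb) ¬Psa
    search (suc d) {a} Pb | no ¬Psa with search d {suc a} (subst P (+-suc (suc a) d) Pb)
    ... | w , sa<w , w≤b , Pw , none = w , <⇒≤ sa<w , subst (w ≤_) (sym (+-suc (suc a) d)) w≤b , Pw , none′
      where
      none′ : ∀ t → a < t → t < w → ¬ P t
      none′ t a<t t<w with m≤n⇒m<n∨m≡n a<t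
      ... | inj₁ sa<t = none t sa<t t<w
      ... | inj₂ refl = ¬Psa

  greatest-below : ∀ {a b} → a < b → P a →
    ∃[ u ] a ≤ u × u < b × P u × (∀ t → u < t → t < b → ¬ P t)
  greatest-below {a} {suc b} a<b Pa with P? b
  ... | yes Pb = b , ≤-pred a<b , ≤-refl , Pb ,
    λ t b<t t<sb _ → <-irrefl refl (<-≤-trans b<t (≤-pred t<sb))
  ... | no ¬Pb with m≤n⇒m<n∨m≡n (≤-pred a<b)
  ... | inj₂ refl = contradiction Pa ¬Pb
  ... | inj₁ a<b′ with greatest-below a<b′ Pa
  ... | u , a≤u , u<b , Pu , none = u , a≤u , m<n⇒m<1+n u<b , Pu , none′
    where
    none′ : ∀ t → u < t → t < suc b → ¬ P t
    none′ t u<t t<sb with m≤n⇒m<n∨m≡n (≤-pred t<sb)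
    ... | inj₁ t<b = none t u<t t<b
    ... | inj₂ refl = ¬Pb

-- Pairs, triples and consecutive vertices

∣p∪q∣≤∣p∣+∣q∣ : ∀ {n} (p q : Subset n) → ∣ p ∪ q ∣ ≤ ∣ p ∣ + ∣ q ∣
∣p∪q∣≤∣p∣+∣q∣ [] [] = z≤n
∣p∪q∣≤∣p∣+∣q∣ (outside ∷ p) (outside ∷ q) = ∣p∪q∣≤∣p∣+∣q∣ p q
∣p∪q∣≤∣p∣+∣q∣ (outside ∷ p) (inside ∷ q) =
  ≤-trans (s≤s (∣p∪q∣≤∣p∣+∣q∣ p q)) (≤-reflexive (sym (+-suc ∣ p ∣ ∣ q ∣)))
∣p∪q∣≤∣p∣+∣q∣ (inside ∷ p) (outside ∷ q) = s≤s (∣p∪q∣≤∣p∣+∣q∣ p q)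
∣p∪q∣≤∣p∣+∣q∣ (inside ∷ p) (inside ∷ q) =
  s≤s (≤-trans (∣p∪q∣≤∣p∣+∣q∣ p q) (+-monoʳ-≤ ∣ p ∣ (n≤1+n ∣ q ∣)))

module _ {N : ℕ} where

  pair : Fin N → Fin N → Subset N
  pair x y = ⁅ x ⁆ ∪ ⁅ y ⁆

  triple : Fin N → Fin N → Fin N → Subset N
  triple x y z = ⁅ x ⁆ ∪ pair y z

  ∈-pair⁺ : ∀ {x y w} → w ≡ x ⊎ w ≡ y → w ∈ pair x y
  ∈-pair⁺ {x} (inj₁ refl) = x∈p∪q⁺ (inj₁ (x∈⁅x⁆ _))
  ∈-pair⁺ {x} (inj₂ refl) = x∈p∪q⁺ {p = ⁅ x ⁆} (inj₂ (x∈⁅x⁆ _))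

  ∈-pair⁻ : ∀ {x y w} → w ∈ pair x y → w ≡ x ⊎ w ≡ y
  ∈-pair⁻ {x} {y} w∈ with x∈p∪q⁻ ⁅ x ⁆ ⁅ y ⁆ w∈
  ... | inj₁ w∈x = inj₁ (x∈⁅y⁆⇒x≡y x w∈x)
  ... | inj₂ w∈y = inj₂ (x∈⁅y⁆⇒x≡y y w∈y)

  ∈-triple⁺ : ∀ {x y z w} → w ≡ x ⊎ w ≡ y ⊎ w ≡ z → w ∈ triple x y z
  ∈-triple⁺ {x} (inj₁ refl) = x∈p∪q⁺ (inj₁ (x∈⁅x⁆ _))
  ∈-triple⁺ {x} (inj₂ w≡) = x∈p∪q⁺ {p = ⁅ x ⁆} (inj₂ (∈-pair⁺ w≡))

  ∈-triple⁻ : ∀ {x y z w} → w ∈ triple x y z → w ≡ x ⊎ w ≡ y ⊎ w ≡ z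
  ∈-triple⁻ {x} {y} {z} w∈ with x∈p∪q⁻ ⁅ x ⁆ (pair y z) w∈
  ... | inj₁ w∈x = inj₁ (x∈⁅y⁆⇒x≡y x w∈x)
  ... | inj₂ w∈yz = inj₂ (∈-pair⁻ w∈yz)

  ∣pair∣≤2 : ∀ x y → ∣ pair x y ∣ ≤ 2
  ∣pair∣≤2 x y = ≤-trans (∣p∪q∣≤∣p∣+∣q∣ ⁅ x ⁆ ⁅ y ⁆)
    (≤-reflexive (cong₂ _+_ (∣⁅x⁆∣≡1 x) (∣⁅x⁆∣≡1 y)))

  ∣triple∣≤3 : ∀ x y z → ∣ triple x y z ∣ ≤ 3
  ∣triple∣≤3 x y z = ≤-trans (∣p∪q∣≤∣p∣+∣q∣ ⁅ x ⁆ (pair y z))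
    (+-mono-≤ (≤-reflexive (∣⁅x⁆∣≡1 x)) (∣pair∣≤2 y z))

  ∣triple∣≥3 : ∀ {x y z} → x ≢ y → y ≢ z → x ≢ z → 3 ≤ ∣ triple x y z ∣
  ∣triple∣≥3 {x} {y} {z} x≢y y≢z x≢z = ≤-<-trans 2≤∣yz∣
    (p⊂q⇒∣p∣<∣q∣ (∈-triple⁺ ∘ inj₂ ∘ ∈-pair⁻ , x , ∈-triple⁺ (inj₁ refl) , x∉yz))
    where
    x∉yz : x ∉ pair y z
    x∉yz x∈ with ∈-pair⁻ x∈
    ... | inj₁ x≡y = x≢y x≡y
    ... | inj₂ x≡z = x≢z x≡z
    2≤∣yz∣ : 2 ≤ ∣ pair y z ∣
    2≤∣yz∣ = ≤-<-trans (≤-reflexive (sym (∣⁅x⁆∣≡1 z)))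
      (p⊂q⇒∣p∣<∣q∣ (∈-pair⁺ ∘ inj₂ ∘ x∈⁅y⁆⇒x≡y z , y , ∈-pair⁺ (inj₁ refl) , y≢z ∘ x∈⁅y⁆⇒x≡y z))

  between-rotate : ∀ {x y z : Fin N} → Between x y z → Between y z x
  between-rotate (inj₁ (x<y , y<z)) = inj₂ (inj₂ (x<y , y<z))
  between-rotate (inj₂ (inj₁ (y<z , z<x))) = inj₁ (y<z , z<x)
  between-rotate (inj₂ (inj₂ (z<x , x<y))) = inj₂ (inj₁ (z<x , x<y))

  between-asym : ∀ {x y z : Fin N} → Between x y z → ¬ Between x z y
  between-asym (inj₁ (x<y , y<z)) (inj₁ (x<z , z<y)) = <-asym y<z z<y
  between-asym (inj₁ (x<y , y<z)) (inj₂ (inj₁ (z<y , y<x))) = <-asym y<z z<y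
  between-asym (inj₁ (x<y , y<z)) (inj₂ (inj₂ (y<x , x<z))) = <-asym x<y y<x
  between-asym (inj₂ (inj₁ (y<z , z<x))) (inj₁ (x<z , z<y)) = <-asym y<z z<y
  between-asym (inj₂ (inj₁ (y<z , z<x))) (inj₂ (inj₁ (z<y , y<x))) = <-asym y<z z<y
  between-asym (inj₂ (inj₁ (y<z , z<x))) (inj₂ (inj₂ (y<x , x<z))) = <-asym z<x x<z
  between-asym (inj₂ (inj₂ (z<x , x<y))) (inj₁ (x<z , z<y)) = <-asym z<x x<z
  between-asym (inj₂ (inj₂ (z<x , x<y))) (inj₂ (inj₁ (z<y , y<x))) = <-asym x<y y<x
  between-asym (inj₂ (inj₂ (z<x , x<y))) (inj₂ (inj₂ (y<x , x<z))) = <-asym x<y y<x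

  between-irreflˡ : ∀ {x y : Fin N} → ¬ Between x x y
  between-irreflˡ (inj₁ (x<x , _)) = <-irrefl refl x<x
  between-irreflˡ (inj₂ (inj₁ (x<y , y<x))) = <-asym x<y y<x
  between-irreflˡ (inj₂ (inj₂ (_ , x<x))) = <-irrefl refl x<x

  between-irreflʳ : ∀ {x y : Fin N} → ¬ Between x y y
  between-irreflʳ = between-irreflˡ ∘ between-rotate

  next-triangle : ∀ {S : Subset N} {x y z} → x ∈ S → y ∈ S →
    (∀ {w} → w ∈ S → w ≡ x ⊎ w ≡ y ⊎ w ≡ z) → Between x y z → Next S x y
  next-triangle {S} {x} {y} {z} x∈S y∈S S⊆xyz xyz =
    x∈S , y∈S , (λ { refl → between-irreflˡ xyz }) , between-free
    where
    between-free : ∀ w → w ∈ S → ¬ Between x w y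
    between-free w w∈S xwy with S⊆xyz w∈S
    ... | inj₁ refl = between-irreflˡ xwy
    ... | inj₂ (inj₁ refl) = between-irreflʳ xwy
    ... | inj₂ (inj₂ refl) = between-asym xyz xwy

  side? : ∀ (x y : Fin N) → Dec (Side ⊤ x y)
  side? x y = next? x y ⊎-dec next? y x
    where
    between? : ∀ (x z y : Fin N) → Dec (Between x z y)
    between? x z y = ((x Fin.<? z) ×-dec (z Fin.<? y))
      ⊎-dec ((z Fin.<? y) ×-dec (y Fin.<? x)) ⊎-dec ((y Fin.<? x) ×-dec (x Fin.<? z))
    next? : ∀ x y → Dec (Next ⊤ x y)
    next? x y = (x ∈? ⊤) ×-dec (y ∈? ⊤) ×-dec ¬? (x Fin.≟ y)
      ×-dec Fin.all? λ z → (z ∈? ⊤) →-dec ¬? (between? x z y)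

  next-⊤⇒next : ∀ {S : Subset N} {x y} → x ∈ S → y ∈ S → Next ⊤ x y → Next S x y
  next-⊤⇒next x∈S y∈S (_ , _ , x≢y , free) = x∈S , y∈S , x≢y , λ z _ → free z ∈⊤

-- Vertices as residues of natural numbers

module Polygon (N′ : ℕ) where

  N : ℕ
  N = suc N′

  -- Positions run over all of ℕ, so that a cyclic configuration can be written as a chain
  -- `i < j < k < N + i` instead of the three cases of `Between`.
  vertex : ℕ → Fin N
  vertex i = fromℕ< (m%n<n i N)

  toℕ-vertex : ∀ i → toℕ (vertex i) ≡ i % N
  toℕ-vertex i = toℕ-fromℕ< (m%n<n i N)

  vertex-cong : ∀ i j → i % N ≡ j % N → vertex i ≡ vertex j
  vertex-cong i j eq = toℕ-injective (trans (toℕ-vertex i) (trans eq (sym (toℕ-vertex j))))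

  vertex-toℕ : ∀ x → vertex (toℕ x) ≡ x
  vertex-toℕ x = toℕ-injective (trans (toℕ-vertex (toℕ x)) (m<n⇒m%n≡m (toℕ<n x)))

  vertex-N+ : ∀ i → vertex (N + i) ≡ vertex i
  vertex-N+ i = vertex-cong (N + i) i (trans (cong (_% N) (+-comm N i)) ([m+n]%n≡m%n i N))

  vertex-*N+ : ∀ q i → vertex (q * N + i) ≡ vertex i
  vertex-*N+ q i = vertex-cong (q * N + i) i (trans (cong (_% N) (+-comm (q * N) i)) ([m+kn]%n≡m%n i q N))

  vertex-+toℕ : ∀ m i → vertex (m + toℕ (vertex i)) ≡ vertex (m + i)
  vertex-+toℕ m i = begin
    vertex (m + toℕ (vertex i))           ≡⟨ cong (λ r → vertex (m + r)) (toℕ-vertex i) ⟩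
    vertex (m + i % N)                    ≡⟨ vertex-*N+ (i / N) (m + i % N) ⟨
    vertex (i / N * N + (m + i % N))      ≡⟨ cong vertex (+-comm (i / N * N) _) ⟩
    vertex (m + i % N + i / N * N)        ≡⟨ cong vertex (+-assoc m _ _) ⟩
    vertex (m + (i % N + i / N * N))      ≡⟨ cong (λ j → vertex (m + j)) (m≡m%n+[m/n]*n i N) ⟨
    vertex (m + i)                        ∎
    where open ≡-Reasoning

  period-split : ∀ i → ∃[ q ] ∃[ r ] r < N × i ≡ q * N + r
  period-split i = i / N , i % N , m%n<n i N ,
    trans (m≡m%n+[m/n]*n i N) (+-comm (i % N) (i / N * N))

  swap-N : ∀ q r → N + (q * N + r) ≡ q * N + (N + r)
  swap-N q r = trans (sym (+-assoc N (q * N) r)) (trans (cong (_+ r) (+-comm N (q * N))) (+-assoc (q * N) N r))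

  -- With `i = q * N + r`, the lift of `z` is `q * N + toℕ z`, or one period later when `toℕ z < r`.
  lift-vertex : ∀ i z → ∃[ j ] i ≤ j × j < N + i × vertex j ≡ z
  lift-vertex i z with period-split i
  ... | q , r , r<N , refl with r ≤? toℕ z
  ... | yes r≤z = q * N + toℕ z , +-monoʳ-≤ (q * N) r≤z ,
    subst (q * N + toℕ z <_) (sym (swap-N q r))
      (+-monoʳ-< (q * N) (<-≤-trans (toℕ<n z) (m≤m+n N r))) ,
    trans (vertex-*N+ q (toℕ z)) (vertex-toℕ z)
  ... | no r≰z = q * N + (N + toℕ z) , +-monoʳ-≤ (q * N) (≤-trans (<⇒≤ r<N) (m≤m+n N (toℕ z))) ,
    subst (q * N + (N + toℕ z) <_) (sym (swap-N q r)) (+-monoʳ-< (q * N) (+-monoʳ-< N (≰⇒> r≰z))) ,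
    trans (vertex-*N+ q (N + toℕ z)) (trans (vertex-N+ (toℕ z)) (vertex-toℕ z))

  -- Removing whole periods reduces to `i < N`. The window up to `N + i` then wraps around at most
  -- once, and which of `j` and `k` lie past `N` selects the disjunct.
  between : ∀ {i j k} → i < j → j < k → k < N + i → Between (vertex i) (vertex j) (vertex k)
  between {i} i<j j<k k<N+i with period-split i
  ... | q , r , r<N , refl
    with m≤n⇒∃[o]m+o≡n (≤-trans (m≤m+n (q * N) r) (<⇒≤ i<j))
       | m≤n⇒∃[o]m+o≡n (≤-trans (≤-trans (m≤m+n (q * N) r) (<⇒≤ i<j)) (<⇒≤ j<k))
  ... | j , refl | k , refl
    rewrite vertex-*N+ q r | vertex-*N+ q j | vertex-*N+ q k =
    reduced r<N (+-cancelˡ-< (q * N) r j i<j) (+-cancelˡ-< (q * N) j k j<k)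
      (+-cancelˡ-< (q * N) k (N + r) (subst (q * N + k <_) (swap-N q r) k<N+i))
    where
    low : ∀ {i} → i < N → toℕ (vertex i) ≡ i
    low {i} i<N = trans (toℕ-vertex i) (m<n⇒m%n≡m i<N)
    position : ∀ {i r} → r < N → i < N + r →
      (i < N × toℕ (vertex i) ≡ i) ⊎ (∃[ k ] i ≡ N + k × toℕ (vertex i) ≡ k)
    position {i} {r} r<N i<N+r with i <? N
    ... | yes i<N = inj₁ (i<N , low i<N)
    ... | no i≮N with m≤n⇒∃[o]m+o≡n (≮⇒≥ i≮N)
    ... | k , refl = inj₂ (k , refl ,
      trans (cong toℕ (vertex-N+ k)) (low (<-trans (+-cancelˡ-< N k r i<N+r) r<N)))
    between-toℕ : ∀ {x y z : Fin N} {a b c} → toℕ x ≡ a → toℕ y ≡ b → toℕ z ≡ c →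
      (a < b × b < c) ⊎ (b < c × c < a) ⊎ (c < a × a < b) → Between x y z
    between-toℕ refl refl refl xyz = xyz
    reduced : ∀ {i j k} → i < N → i < j → j < k → k < N + i → Between (vertex i) (vertex j) (vertex k)
    reduced {i} i<N i<j j<k k<N+i with position i<N (<-trans j<k k<N+i) | position i<N k<N+i
    ... | inj₁ (_ , j≡) | inj₁ (_ , k≡) = between-toℕ (low i<N) j≡ k≡ (inj₁ (i<j , j<k))
    ... | inj₁ (_ , j≡) | inj₂ (k′ , refl , k≡) =
      between-toℕ (low i<N) j≡ k≡ (inj₂ (inj₂ (+-cancelˡ-< N k′ i k<N+i , i<j)))
    ... | inj₂ (j′ , refl , j≡) | inj₁ (k<N , _) = contradiction (<-trans j<k k<N) (m+n≮m N j′)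
    ... | inj₂ (j′ , refl , j≡) | inj₂ (k′ , refl , k≡) =
      between-toℕ (low i<N) j≡ k≡ (inj₂ (inj₁ (+-cancelˡ-< N j′ k′ j<k , +-cancelˡ-< N k′ i k<N+i)))

  -- The lift of `z` to the window from `i` must lie strictly between `i` and `k`, by irreflexivity
  -- and asymmetry of `Between`.
  between⁻¹ : ∀ {i k z} → i < k → k < N + i → Between (vertex i) z (vertex k) →
    ∃[ j ] i < j × j < k × vertex j ≡ z
  between⁻¹ {i} {k} {z} i<k k<N+i izk with lift-vertex i z
  ... | j , i≤j , j<N+i , refl with m≤n⇒m<n∨m≡n i≤j
  ... | inj₂ refl = contradiction izk between-irreflˡ
  ... | inj₁ i<j with <-cmp j k
  ... | tri< j<k _ _ = j , i<j , j<k , refl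
  ... | tri≈ _ refl _ = contradiction izk between-irreflʳ
  ... | tri> _ _ k<j = contradiction (between i<k k<j j<N+i) (between-asym izk)

-- Triangulations from friezes

-- A Coxeter frieze pattern, with `ℓ` in the role of lengths in Ptolemy's theorem. The inequalities
-- in `ptolemy` are weak because the walks in `apex` and `fan` start at degenerate quadruples.
record Frieze (N′ : ℕ) : Set where
  open Polygon N′ using (N)
  field
    ℓ          : ℕ → ℕ → ℕ
    ℓ-refl     : ∀ i → ℓ i i ≡ 0
    ℓ-sym      : ∀ i j → ℓ i j ≡ ℓ j i
    ℓ-suc      : ∀ i → ℓ i (suc i) ≡ 1
    ℓ-periodic : ∀ i j → ℓ i (N + j) ≡ ℓ i j
    ℓ-positive : ∀ {i j} → i < j → j < N + i → 0 < ℓ i j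
    ptolemy    : ∀ {i j k l} → i ≤ j → j ≤ k → k ≤ l → l ≤ N + i →
                 ℓ i k * ℓ j l ≡ ℓ i j * ℓ k l + ℓ i l * ℓ j k

module Dissection {N′ : ℕ} (F : Frieze N′) where
  open Frieze F
  open Polygon N′

  ℓ-toℕ-vertex : ∀ i j → ℓ i (toℕ (vertex j)) ≡ ℓ i j
  ℓ-toℕ-vertex i j = begin
    ℓ i (toℕ (vertex j))          ≡⟨ cong (ℓ i) (toℕ-vertex j) ⟩
    ℓ i (j % N)                   ≡⟨ periods (j / N) (j % N) ⟨
    ℓ i (j / N * N + j % N)       ≡⟨ cong (ℓ i) (trans (m≡m%n+[m/n]*n j N) (+-comm (j % N) _)) ⟨
    ℓ i j                         ∎
    where
    open ≡-Reasoning
    periods : ∀ q j → ℓ i (q * N + j) ≡ ℓ i j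
    periods zero    j = refl
    periods (suc q) j = trans (cong (ℓ i) (+-assoc N (q * N) j)) (trans (ℓ-periodic i _) (periods q j))

  Chord : Rel (Fin N) _
  Chord x y = ℓ (toℕ x) (toℕ y) ≡ 1

  ℓ-vertices : ∀ i j → ℓ (toℕ (vertex i)) (toℕ (vertex j)) ≡ ℓ i j
  ℓ-vertices i j = begin
    ℓ (toℕ (vertex i)) (toℕ (vertex j)) ≡⟨ ℓ-toℕ-vertex _ j ⟩
    ℓ (toℕ (vertex i)) j                ≡⟨ ℓ-sym _ j ⟩
    ℓ j (toℕ (vertex i))                ≡⟨ ℓ-toℕ-vertex j i ⟩
    ℓ j i                               ≡⟨ ℓ-sym j i ⟩
    ℓ i j                               ∎
    where open ≡-Reasoning

  chord⁺ : ∀ {i j} → ℓ i j ≡ 1 → Chord (vertex i) (vertex j)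
  chord⁺ {i} {j} = trans (ℓ-vertices i j)

  chord⁻ : ∀ {i j} → Chord (vertex i) (vertex j) → ℓ i j ≡ 1
  chord⁻ {i} {j} = trans (sym (ℓ-vertices i j))

  chord-sym : ∀ {x y} → Chord x y → Chord y x
  chord-sym {x} {y} = trans (ℓ-sym (toℕ y) (toℕ x))

  -- Since `ℓ` depends only on the vertices, equal vertices would give `ℓ i j = 0`, against
  -- positivity.
  vertex-≢ : ∀ {i j} → i < j → j < N + i → vertex i ≢ vertex j
  vertex-≢ {i} {j} i<j j<N+i eq = <⇒≢ (ℓ-positive i<j j<N+i) (sym (begin
    ℓ i j                               ≡⟨ ℓ-vertices i j ⟨
    ℓ (toℕ (vertex i)) (toℕ (vertex j)) ≡⟨ cong (λ x → ℓ (toℕ (vertex i)) (toℕ x)) eq ⟨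
    ℓ (toℕ (vertex i)) (toℕ (vertex i)) ≡⟨ ℓ-refl (toℕ (vertex i)) ⟩
    0                                   ∎))
    where open ≡-Reasoning

  -- This excludes `N = 1`, where periodicity would force `ℓ i (suc i)` to be 0 as well as 1.
  suc<N+ : ∀ i → suc i < N + i
  suc<N+ i with m≤n⇒m<n∨m≡n (m<n+m i {N} z<s)
  ... | inj₁ si<N+i = si<N+i
  ... | inj₂ si≡N+i = contradiction
    (trans (sym (ℓ-suc i)) (trans (cong (ℓ i) si≡N+i) (trans (ℓ-periodic i i) (ℓ-refl i)))) λ ()

  -- Crossing pairs have ℓ i k * ℓ j l ≥ 1 + 1 by Ptolemy.
  no-crossing : ∀ {i j k l} → i < j → j < k → k < l → l < N + i → ℓ i k ≡ 1 → ℓ j l ≢ 1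
  no-crossing {i} {j} {k} {l} i<j j<k k<l l<N+i ik jl = <⇒≢ (+-mono-≤
      (*-mono-≤ (ℓ-positive i<j (<-trans (<-trans j<k k<l) l<N+i))
                (ℓ-positive k<l (<-≤-trans l<N+i (+-monoʳ-≤ N (<⇒≤ (<-trans i<j j<k))))))
      (*-mono-≤ (ℓ-positive (<-trans (<-trans i<j j<k) k<l) l<N+i)
                (ℓ-positive j<k (<-trans (<-trans k<l l<N+i) (+-monoʳ-< N i<j)))))
    (sym (trans (sym (ptolemy (<⇒≤ i<j) (<⇒≤ j<k) (<⇒≤ k<l) (<⇒≤ l<N+i))) (cong₂ _*_ ik jl)))

  -- ℓ i k / ℓ k j increases from 0 to ∞ through Farey neighbours, so it takes the
  -- value 1/1: it does so at the first k with ℓ k j ≤ ℓ i k.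
  apex : ∀ {i j} → suc i < j → j < N + i → ℓ i j ≡ 1 →
    ∃[ k ] i < k × k < j × ℓ i k ≡ 1 × ℓ k j ≡ 1
  apex {i} {j} si<j j<N+i ij = start
    where
    -- The ratios `q / p` and `q′ / p′` are the values at `k` and `suc k`, on either side of 1.
    -- Comparing `q′ * (q + 1)` with `q * q′ + 1` forces `q′ ≤ 1`.
    unimodular : ∀ {p q p′ q′} → q′ * p ≡ q * p′ + 1 → q < p → p′ ≤ q′ → 0 < p′ → q′ ≡ 1 × p′ ≡ 1
    unimodular {p} {q} {p′} {q′} eq q<p p′≤q′ 0<p′ =
      ≤-antisym q′≤1 (≤-trans 0<p′ p′≤q′) , ≤-antisym (≤-trans p′≤q′ q′≤1) 0<p′
      where
      open ≤-Reasoning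
      q′≤1 : q′ ≤ 1
      q′≤1 = +-cancelʳ-≤ (q′ * q) q′ 1 (begin
        q′ + q′ * q   ≡⟨ *-suc q′ q ⟨
        q′ * suc q    ≤⟨ *-monoʳ-≤ q′ q<p ⟩
        q′ * p        ≡⟨ eq ⟩
        q * p′ + 1    ≤⟨ +-monoˡ-≤ 1 (*-monoʳ-≤ q p′≤q′) ⟩
        q * q′ + 1    ≡⟨ +-comm (q * q′) 1 ⟩
        1 + q * q′    ≡⟨ cong suc (*-comm q q′) ⟩
        1 + q′ * q    ∎)
    search : ∀ d k → k + d ≡ j → i ≤ k → ℓ i k < ℓ k j →
      ∃[ k ] i < k × k < j × ℓ i k ≡ 1 × ℓ k j ≡ 1
    search zero k k+0≡j i≤k q<p with trans (sym (+-identityʳ k)) k+0≡j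
    ... | refl = contradiction (subst (ℓ i j <_) (ℓ-refl j) q<p) λ ()
    search (suc d) k k+sd≡j i≤k q<p with trans (sym (+-suc k d)) k+sd≡j
    ... | sk+d≡j with ℓ i (suc k) <? ℓ (suc k) j
    ... | yes q′<p′ = search d (suc k) sk+d≡j (m≤n⇒m≤1+n i≤k) q′<p′
    -- The search stops strictly before `j`, which makes `p′` positive: at `suc k = j` the
    -- inequality `q < p = 1` would give `ℓ i k = 0`, impossible for `i < k`, while `k = i`
    -- contradicts `suc i < j`.
    ... | no q′≮p′ with m≤n⇒m<n∨m≡n (m+n≤o⇒m≤o (suc k) (≤-reflexive sk+d≡j)) | m≤n⇒m<n∨m≡n i≤k
    ... | inj₂ refl | inj₂ refl = contradiction si<j (<-irrefl refl)
    ... | inj₂ refl | inj₁ i<k = contradiction (subst (ℓ i k <_) (ℓ-suc k) q<p)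
      (<⇒≱ (s≤s (ℓ-positive i<k (<-trans ≤-refl j<N+i))))
    ... | inj₁ sk<j | _ with unimodular
      (trans (ptolemy i≤k (n≤1+n k) (<⇒≤ sk<j) (<⇒≤ j<N+i))
             (cong (λ t → ℓ i k * ℓ (suc k) j + t) (cong₂ _*_ ij (ℓ-suc k))))
      q<p (≮⇒≥ q′≮p′) (ℓ-positive sk<j (<-≤-trans j<N+i (+-monoʳ-≤ N (m≤n⇒m≤1+n i≤k))))
    ... | q′≡1 , p′≡1 = suc k , s≤s i≤k , sk<j , q′≡1 , p′≡1
    start : ∃[ k ] i < k × k < j × ℓ i k ≡ 1 × ℓ k j ≡ 1
    start with m≤n⇒∃[o]m+o≡n (<⇒≤ (<-trans (n<1+n i) si<j))
    ... | d , i+d≡j = search d i i+d≡j ≤-refl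
      (subst₂ _<_ (sym (ℓ-refl i)) (sym ij) z<s)

  next-⊤⁻ : ∀ {x y} → Next ⊤ x y → ∃[ i ] vertex i ≡ x × vertex (suc i) ≡ y
  next-⊤⁻ {x} {y} (_ , _ , x≢y , free) with lift-vertex 0 x
  ... | i , _ , _ , refl with lift-vertex i y
  ... | j , i≤j , j<N+i , refl with m≤n⇒m<n∨m≡n i≤j
  ... | inj₂ refl = contradiction refl x≢y
  ... | inj₁ i<j with m≤n⇒m<n∨m≡n i<j
  ... | inj₂ refl = i , refl , refl
  ... | inj₁ si<j = contradiction (between ≤-refl si<j j<N+i) (free (vertex (suc i)) ∈⊤)

  next-⊤⁺ : ∀ i → Next ⊤ (vertex i) (vertex (suc i))
  next-⊤⁺ i = ∈⊤ , ∈⊤ , vertex-≢ ≤-refl (suc<N+ i) , free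
    where
    free : ∀ z → z ∈ ⊤ → ¬ Between (vertex i) z (vertex (suc i))
    free z _ b with between⁻¹ ≤-refl (suc<N+ i) b
    ... | t , i<t , t<si , _ = <⇒≱ i<t (≤-pred t<si)

  next-chord : ∀ {x y} → Next ⊤ x y → Chord x y
  next-chord next with next-⊤⁻ next
  ... | i , refl , refl = chord⁺ (ℓ-suc i)

  side-chord : ∀ {x y} → Side ⊤ x y → Chord x y
  side-chord (inj₁ next) = next-chord next
  side-chord {x} {y} (inj₂ next) = chord-sym {y} {x} (next-chord next)

  -- `Chord` treats sides and diagonals alike, which keeps the arguments uniform; a `Triangulation`
  -- admits only the diagonals.
  D : Rel (Fin N) _
  D x y = Chord x y × ¬ Side ⊤ x y

  -- Rotational symmetry of the diagonals

  module _ m (ℓ-rotate : ∀ i j → ℓ (m + i) (m + j) ≡ ℓ i j)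
           (vertex-m+m+ : ∀ i → vertex (m + (m + i)) ≡ vertex i) where

    rotate : Fin N → Fin N
    rotate x = vertex (m + toℕ x)

    rotate-involutive : ∀ x → rotate (rotate x) ≡ x
    rotate-involutive x = trans (vertex-+toℕ m (m + toℕ x)) (trans (vertex-m+m+ (toℕ x)) (vertex-toℕ x))

    next-rotate : ∀ {x y} → Next ⊤ x y → Next ⊤ (rotate x) (rotate y)
    next-rotate next with next-⊤⁻ next
    ... | i , refl , refl = subst₂ (Next ⊤) (sym (vertex-+toℕ m i))
      (trans (cong vertex (sym (+-suc m i))) (sym (vertex-+toℕ m (suc i)))) (next-⊤⁺ (m + i))

    side-rotate : ∀ {x y} → Side ⊤ x y → Side ⊤ (rotate x) (rotate y)
    side-rotate (inj₁ next) = inj₁ (next-rotate next)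
    side-rotate (inj₂ next) = inj₂ (next-rotate next)

    -- Chords are preserved by invariance of `ℓ`. If the image were a side, rotating once more would
    -- make the original pair a side, since rotation is an involution.
    D-rotate : ∀ {x y} → D x y → D (rotate x) (rotate y)
    D-rotate {x} {y} (chord , ¬side) =
      trans (ℓ-vertices (m + toℕ x) (m + toℕ y)) (trans (ℓ-rotate (toℕ x) (toℕ y)) chord) ,
      ¬side ∘ subst₂ (Side ⊤) (rotate-involutive x) (rotate-involutive y) ∘ side-rotate

    D-rotate⇔ : ∀ x y → D x y ⇔ D (rotate x) (rotate y)
    D-rotate⇔ x y = mk⇔ D-rotate
      (subst₂ D (rotate-involutive x) (rotate-involutive y) ∘ D-rotate)

  chord⇒side⊎D : ∀ {x y} → Chord x y → Side ⊤ x y ⊎ D x y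
  chord⇒side⊎D {x} {y} chord with side? x y
  ... | yes side = inj₁ side
  ... | no ¬side = inj₂ (chord , ¬side)

  chord-≢ : ∀ {x y} → Chord x y → x ≢ y
  chord-≢ {x} chord refl = contradiction (trans (sym (ℓ-refl (toℕ x))) chord) λ ()

  D-nonCrossing : ∀ {x y u v} → D x y → D u v → ¬ Cross x y u v
  D-nonCrossing {x} {y} {u} {v} (xy , _) (uv , _) (xuy , yvx) with lift-vertex 0 x
  ... | i , _ , _ , refl with lift-vertex i y
  ... | k , i≤k , k<N+i , refl with m≤n⇒m<n∨m≡n i≤k
  ... | inj₂ refl = chord-≢ xy refl
  -- The second chord is lifted with `u` between `i` and `k` and `v` between `k` and `N + i`, the
  -- next lift of `x`, which puts all four positions in one chain.
  ... | inj₁ i<k with between⁻¹ i<k k<N+i xuy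
                    | between⁻¹ k<N+i (+-monoʳ-< N i<k) (subst (Between (vertex k) v) (sym (vertex-N+ i)) yvx)
  ... | j , i<j , j<k , refl | l , k<l , l<N+i , refl =
    no-crossing i<j j<k k<l l<N+i (chord⁻ xy) (chord⁻ uv)

  -- Regions are triangles

  Free : Subset N → ℕ → ℕ → Set
  Free S i j = ∀ t → i < t → t < j → vertex t ∉ S

  two-points : ∀ {S i j} → Free S i j → Free S j (N + i) → ∣ S ∣ ≤ 2
  two-points {S} {i} {j} ij ji = ≤-trans (p⊆q⇒∣p∣≤∣q∣ (∈-pair⁺ ∘ locate)) (∣pair∣≤2 (vertex i) (vertex j))
    where
    locate : ∀ {x} → x ∈ S → x ≡ vertex i ⊎ x ≡ vertex j
    locate {x} x∈S with lift-vertex i x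
    ... | t , i≤t , t<N+i , refl with m≤n⇒m<n∨m≡n i≤t
    ... | inj₂ refl = inj₁ refl
    ... | inj₁ i<t with <-cmp t j
    ... | tri< t<j _ _ = contradiction x∈S (ij t i<t t<j)
    ... | tri≈ _ refl _ = inj₂ refl
    ... | tri> _ _ j<t = contradiction x∈S (ji t j<t t<N+i)

  free-suc : ∀ {S} i → Free S i (suc i)
  free-suc i t i<t t<si = contradiction (≤-pred t<si) (<⇒≱ i<t)

  module Region {S : Subset N} (region : IsRegion D S) where
    open IsRegion region

    ¬two-points : ∀ {i j} → Free S i j → ¬ Free S j (N + i)
    ¬two-points ij ji = <⇒≱ polygon (two-points ij ji)

    next-vertex : ∀ {i j} → i < j → j < N + i → vertex i ∈ S → vertex j ∈ S → Free S i j →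
      Next S (vertex i) (vertex j)
    next-vertex {i} {j} i<j j<N+i i∈S j∈S free = i∈S , j∈S , vertex-≢ i<j j<N+i , between-free
      where
      between-free : ∀ z → z ∈ S → ¬ Between (vertex i) z (vertex j)
      between-free z z∈S izj with between⁻¹ i<j j<N+i izj
      ... | t , i<t , t<j , refl = free t i<t t<j z∈S

    consecutive : ∀ {i j} → i < j → j < N + i → vertex i ∈ S → vertex j ∈ S → Free S i j → ℓ i j ≡ 1
    consecutive i<j j<N+i i∈S j∈S free with boundary (inj₁ (next-vertex i<j j<N+i i∈S j∈S free))
    ... | inj₁ side = chord⁻ (side-chord side)
    ... | inj₂ (chord , _) = chord⁻ chord

    chord-side : ∀ {x y} → x ∈ S → y ∈ S → Chord x y → Side S x y
    chord-side {x} {y} x∈S y∈S chord with chord⇒side⊎D {x} {y} chord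
    ... | inj₁ (inj₁ next) = inj₁ (next-⊤⇒next x∈S y∈S next)
    ... | inj₁ (inj₂ next) = inj₂ (next-⊤⇒next y∈S x∈S next)
    ... | inj₂ d = undivided x∈S y∈S d

    -- A chord between vertices of `S` is a side of `S`, so one of its two arcs misses `S`; it is
    -- not the arc that contains `k`.
    chord-free : ∀ {i j k} → i < j → j < k → k < N + i →
      vertex i ∈ S → vertex j ∈ S → vertex k ∈ S → ℓ i j ≡ 1 → Free S i j
    chord-free i<j j<k k<N+i i∈S j∈S k∈S ij with chord-side i∈S j∈S (chord⁺ ij)
    ... | inj₁ (_ , _ , _ , free) = λ t i<t t<j t∈S →
      free (vertex t) t∈S (between i<t t<j (<-trans j<k k<N+i))
    ... | inj₂ (_ , _ , _ , free) =
      contradiction (between-rotate (between i<j j<k k<N+i)) (free _ k∈S)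

    -- If `k` were not in `S`, the nearest vertices `u` and `w` of `S` around it would be
    -- consecutive, hence joined by a chord. It crosses `{j, k}` unless `u = j`, and `{k, i}` unless
    -- `w = N + i`; in the remaining case `S` has only two vertices.
    apex-∈ : ∀ {i j k} → i < j → j < k → k < N + i → vertex i ∈ S → vertex j ∈ S →
      Free S i j → ℓ j k ≡ 1 → ℓ k (N + i) ≡ 1 → vertex k ∈ S
    apex-∈ {i} {j} {k} i<j j<k k<N+i i∈S j∈S free jk ki with vertex k ∈? S
    ... | yes k∈S = k∈S
    ... | no k∉S with greatest-below (λ t → vertex t ∈? S) j<k j∈S
                    | least-above (λ t → vertex t ∈? S) k<N+i (subst (_∈ S) (sym (vertex-N+ i)) i∈S)
    ... | u , j≤u , u<k , u∈S , uk | w , k<w , w≤N+i , w∈S , kw =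
      contradiction (consecutive (<-trans u<k k<w) w<N+u u∈S w∈S uw) ¬uw
      where
      w<N+u : w < N + u
      w<N+u = ≤-<-trans w≤N+i (+-monoʳ-< N (<-≤-trans i<j j≤u))
      uw : Free S u w
      uw t u<t t<w with <-cmp t k
      ... | tri< t<k _ _ = uk t u<t t<k
      ... | tri≈ _ refl _ = k∉S
      ... | tri> _ _ k<t = kw t k<t t<w
      ¬uw : ℓ u w ≢ 1
      ¬uw ℓuw with m≤n⇒m<n∨m≡n j≤u | m≤n⇒m<n∨m≡n w≤N+i
      ... | inj₁ j<u  | _ = no-crossing j<u u<k k<w (≤-<-trans w≤N+i (+-monoʳ-< N i<j)) jk ℓuw
      ... | inj₂ refl | inj₁ w<N+i = no-crossing u<k k<w w<N+i (+-monoʳ-< N i<j) ℓuw ki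
      ... | inj₂ refl | inj₂ refl = ¬two-points free uw

    -- Once `k` is known to lie in `S`, `chord-free`, applied along the cycle with positions moved
    -- up by `N`, shows that the other two arcs miss `S` too.
    ≡-triple : ∀ {i j k} → i < j → j < k → k < N + i → vertex i ∈ S → vertex j ∈ S →
      Free S i j → ℓ j k ≡ 1 → ℓ k (N + i) ≡ 1 → S ≡ triple (vertex i) (vertex j) (vertex k)
    ≡-triple {i} {j} {k} i<j j<k k<N+i i∈S j∈S ij ℓjk ℓki =
      ⊆-antisym (∈-triple⁺ ∘ locate) (member ∘ ∈-triple⁻)
      where
      k∈S : vertex k ∈ S
      k∈S = apex-∈ i<j j<k k<N+i i∈S j∈S ij ℓjk ℓki
      N+_∈S : ∀ {t} → vertex t ∈ S → vertex (N + t) ∈ S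
      N+_∈S {t} = subst (_∈ S) (sym (vertex-N+ t))
      jk : Free S j k
      jk = chord-free j<k k<N+i (+-monoʳ-< N i<j) j∈S k∈S N+ i∈S ∈S ℓjk
      ki : Free S k (N + i)
      ki = chord-free k<N+i (+-monoʳ-< N i<j) (+-monoʳ-< N j<k) k∈S N+ i∈S ∈S N+ j∈S ∈S ℓki
      locate : ∀ {x} → x ∈ S → x ≡ vertex i ⊎ x ≡ vertex j ⊎ x ≡ vertex k
      locate {x} x∈S with lift-vertex i x
      ... | t , i≤t , t<N+i , refl with m≤n⇒m<n∨m≡n i≤t | <-cmp t j | <-cmp t k
      ... | inj₂ refl | _ | _ = inj₁ refl
      ... | inj₁ i<t | tri< t<j _ _ | _ = contradiction x∈S (ij t i<t t<j)
      ... | inj₁ i<t | tri≈ _ refl _ | _ = inj₂ (inj₁ refl)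
      ... | inj₁ i<t | tri> _ _ j<t | tri< t<k _ _ = contradiction x∈S (jk t j<t t<k)
      ... | inj₁ i<t | tri> _ _ j<t | tri≈ _ refl _ = inj₂ (inj₂ refl)
      ... | inj₁ i<t | tri> _ _ j<t | tri> _ _ k<t = contradiction x∈S (ki t k<t t<N+i)
      member : ∀ {x} → x ≡ vertex i ⊎ x ≡ vertex j ⊎ x ≡ vertex k → x ∈ S
      member (inj₁ refl) = i∈S
      member (inj₂ (inj₁ refl)) = j∈S
      member (inj₂ (inj₂ refl)) = k∈S

    -- Let `j` follow `i` in `S`, so that `{i, j}` is a chord. Its `apex` over the far arc, from `j`
    -- to `N + i`, is the third vertex, and `≡-triple` leaves no room for a fourth.
    ∣region∣≡3 : ∣ S ∣ ≡ 3
    ∣region∣≡3 with nonempty? S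
    ... | no empty = contradiction
      (subst (λ S → 3 ≤ ∣ S ∣) (Empty-unique empty) polygon)
      (subst (λ m → ¬ 3 ≤ m) (sym (∣⊥∣≡0 N)) λ ())
    ... | yes (x , x∈S) with lift-vertex 0 x
    ... | i , _ , _ , refl
      with least-above (λ t → vertex t ∈? S) (m<n+m i {N} z<s) (subst (_∈ S) (sym (vertex-N+ i)) x∈S)
    ... | j , i<j , j≤N+i , j∈S , ij with m≤n⇒m<n∨m≡n j≤N+i
    -- With `j = N + i` the set `S` would have the single vertex `i`; with `suc j = N + i` it would
    -- have only `i` and `j`.
    ... | inj₂ refl = contradiction (λ t si<t → ij t (<⇒≤ si<t)) (¬two-points (free-suc i))
    ... | inj₁ j<N+i with m≤n⇒m<n∨m≡n j<N+i
    ... | inj₂ sj≡N+i = contradiction (subst (Free S j) sj≡N+i (free-suc j)) (¬two-points ij)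
    ... | inj₁ sj<N+i with apex sj<N+i (+-monoʳ-< N i<j)
      (trans (ℓ-periodic j i) (trans (ℓ-sym j i) (consecutive i<j j<N+i x∈S j∈S ij)))
    ... | k , j<k , k<N+i , jk , ki = ≤-antisym
      (subst (λ T → ∣ T ∣ ≤ 3) (sym (≡-triple i<j j<k k<N+i x∈S j∈S ij jk ki))
        (∣triple∣≤3 (vertex i) (vertex j) (vertex k)))
      polygon

  -- Any two distinct corners are joined by a chord and also form a side of the triple; the first
  -- fact gives `boundary`, the second `undivided`.
  triangle-region : ∀ {i j k} → i < j → j < k → k < N + i →
    ℓ i j ≡ 1 → ℓ j k ≡ 1 → ℓ k (N + i) ≡ 1 →
    IsRegion D (triple (vertex i) (vertex j) (vertex k))
  triangle-region {i} {j} {k} i<j j<k k<N+i ij jk ki = record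
    { polygon   = ∣triple∣≥3 (chord-≢ chord-ij) (chord-≢ chord-jk) (chord-≢ chord-ik)
    ; boundary  = boundary
    ; undivided = λ { x∈T y∈T (xy , _) → side (∈-triple⁻ x∈T) (∈-triple⁻ y∈T) (chord-≢ xy) }
    }
    where
    x = vertex i
    y = vertex j
    z = vertex k
    T = triple x y z
    chord-ij : Chord x y
    chord-ij = chord⁺ ij
    chord-jk : Chord y z
    chord-jk = chord⁺ jk
    chord-ik : Chord x z
    chord-ik = chord⁺ (trans (ℓ-sym i k) (trans (sym (ℓ-periodic k i)) ki))
    xyz : Between x y z
    xyz = between i<j j<k k<N+i
    chord : ∀ {u v} → u ≡ x ⊎ u ≡ y ⊎ u ≡ z → v ≡ x ⊎ v ≡ y ⊎ v ≡ z → u ≢ v → Chord u v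
    chord (inj₁ refl) (inj₁ refl) u≢v = contradiction refl u≢v
    chord (inj₁ refl) (inj₂ (inj₁ refl)) _ = chord-ij
    chord (inj₁ refl) (inj₂ (inj₂ refl)) _ = chord-ik
    chord (inj₂ (inj₁ refl)) (inj₁ refl) _ = chord-sym {x} {y} chord-ij
    chord (inj₂ (inj₁ refl)) (inj₂ (inj₁ refl)) u≢v = contradiction refl u≢v
    chord (inj₂ (inj₁ refl)) (inj₂ (inj₂ refl)) _ = chord-jk
    chord (inj₂ (inj₂ refl)) (inj₁ refl) _ = chord-sym {x} {z} chord-ik
    chord (inj₂ (inj₂ refl)) (inj₂ (inj₁ refl)) _ = chord-sym {y} {z} chord-jk
    chord (inj₂ (inj₂ refl)) (inj₂ (inj₂ refl)) u≢v = contradiction refl u≢v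
    boundary : ∀ {u v} → Side T u v → Side ⊤ u v ⊎ D u v
    boundary (inj₁ (u∈T , v∈T , u≢v , _)) = chord⇒side⊎D (chord (∈-triple⁻ u∈T) (∈-triple⁻ v∈T) u≢v)
    boundary (inj₂ (v∈T , u∈T , v≢u , _)) = chord⇒side⊎D (chord (∈-triple⁻ u∈T) (∈-triple⁻ v∈T) (v≢u ∘ sym))
    x∈T : x ∈ T
    x∈T = ∈-triple⁺ (inj₁ refl)
    y∈T : y ∈ T
    y∈T = ∈-triple⁺ (inj₂ (inj₁ refl))
    z∈T : z ∈ T
    z∈T = ∈-triple⁺ (inj₂ (inj₂ refl))
    cycle : ∀ {A B C : Set} → A ⊎ B ⊎ C → B ⊎ C ⊎ A
    cycle (inj₁ a) = inj₂ (inj₂ a)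
    cycle (inj₂ (inj₁ b)) = inj₁ b
    cycle (inj₂ (inj₂ c)) = inj₂ (inj₁ c)
    next-xy : Next T x y
    next-xy = next-triangle x∈T y∈T ∈-triple⁻ xyz
    next-yz : Next T y z
    next-yz = next-triangle y∈T z∈T (cycle ∘ ∈-triple⁻) (between-rotate xyz)
    next-zx : Next T z x
    next-zx = next-triangle z∈T x∈T (cycle ∘ cycle ∘ ∈-triple⁻) (between-rotate (between-rotate xyz))
    side : ∀ {u v} → u ≡ x ⊎ u ≡ y ⊎ u ≡ z → v ≡ x ⊎ v ≡ y ⊎ v ≡ z → u ≢ v → Side T u v
    side (inj₁ refl) (inj₁ refl) u≢v = contradiction refl u≢v
    side (inj₁ refl) (inj₂ (inj₁ refl)) _ = inj₁ next-xy
    side (inj₁ refl) (inj₂ (inj₂ refl)) _ = inj₂ next-zx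
    side (inj₂ (inj₁ refl)) (inj₁ refl) _ = inj₂ next-xy
    side (inj₂ (inj₁ refl)) (inj₂ (inj₁ refl)) u≢v = contradiction refl u≢v
    side (inj₂ (inj₁ refl)) (inj₂ (inj₂ refl)) _ = inj₁ next-yz
    side (inj₂ (inj₂ refl)) (inj₁ refl) _ = inj₁ next-zx
    side (inj₂ (inj₂ refl)) (inj₂ (inj₁ refl)) _ = inj₂ next-yz
    side (inj₂ (inj₂ refl)) (inj₂ (inj₂ refl)) u≢v = contradiction refl u≢v

  triangulation : Triangulation N
  triangulation = record
    { D           = D
    ; D?          = λ x y → (ℓ (toℕ x) (toℕ y) ≟ 1) ×-dec ¬? (side? x y)
    ; symmetric   = λ { {x} {y} (xy , ¬side) → chord-sym {x} {y} xy , ¬side ∘ swap }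
    ; diagonal    = λ { (xy , ¬side) → chord-≢ xy , ¬side }
    ; nonCrossing = D-nonCrossing
    ; triangular  = Region.∣region∣≡3
    }

  -- Counting the triangles at a vertex

  module Fan (v : ℕ) where

    -- The triangles at `v` not yet passed when `u` sweeps around the polygon; at `u = suc v` the
    -- last condition is vacuous.
    Beyond : ℕ → Subset N → Set
    Beyond u S = IsRegion D S × vertex v ∈ S × Free S v u

    height : ℕ → ℕ
    height = ℓ (suc v)

    -- Ptolemy for `v`, `suc v`, `u`, `w`. When `u` and `w` are also joined, the height grows by
    -- exactly 1, so it can serve as a counter.
    height-step : ∀ {u w} → v < u → u ≤ w → w ≤ N + v → ℓ v u ≡ 1 → ℓ v w ≡ 1 →
      height w ≡ ℓ u w + height u
    height-step {u} {w} v<u u≤w w≤N+v vu vw = begin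
      height w                                   ≡⟨ *-identityˡ _ ⟨
      1 * height w                               ≡⟨ cong (_* height w) vu ⟨
      ℓ v u * height w                           ≡⟨ ptolemy (n≤1+n v) v<u u≤w w≤N+v ⟩
      ℓ v (suc v) * ℓ u w + ℓ v w * height u     ≡⟨ cong₂ (λ p q → p * ℓ u w + q * height u) (ℓ-suc v) vw ⟩
      1 * ℓ u w + 1 * height u                   ≡⟨ cong₂ _+_ (*-identityˡ (ℓ u w)) (*-identityˡ (height u)) ⟩
      ℓ u w + height u                           ∎
      where open ≡-Reasoning

    -- The neighbour of `v` on the other side, as `suc last` is `N + v`.
    last : ℕ
    last = N′ + v

    ℓ-last : ℓ v last ≡ 1
    ℓ-last = trans (ℓ-sym v last) (trans (sym (ℓ-periodic last v)) (ℓ-suc last))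

    -- The triangles at v, listed from the one with side {v, u} on; m is the number left.
    fan : ∀ m {u} → v < u → u ≤ last → ℓ v u ≡ 1 → height u + m ≡ height last →
      HasCardinality (Beyond u) m
    fan zero {u} v<u u≤last vu hu with m≤n⇒m<n∨m≡n u≤last
    -- Before `last` the height has still to grow by `ℓ u last`, which is positive.
    ... | inj₁ u<last = contradiction
      (trans (sym (height-step v<u u≤last (n≤1+n last) vu ℓ-last)) (trans (sym hu) (+-identityʳ (height u))))
      (>⇒≢ (m<n+m (height u) (ℓ-positive u<last (<-trans ≤-refl (+-monoʳ-< N v<u)))))
    ... | inj₂ refl = [] , [] , (λ S → mk⇔ (λ ()) none) , refl
      where
      none : ∀ {S} → Beyond last S → _
      -- Both arcs between `v` and `last` would miss `S`, the second because it is a single side.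
      none (region , _ , free) = contradiction (free-suc last) (Region.¬two-points region free)
    fan (suc m) {u} v<u u≤last vu hu with m≤n⇒m<n∨m≡n u≤last
    ... | inj₂ refl = contradiction hu (m+1+n≢m (height u))
    -- The apex over the arc from `u` to `N + v` yields the next triangle `{v, u, k}`; the sweep
    -- continues at `k`, where the height is one more.
    ... | inj₁ u<last with apex (s≤s u<last) (+-monoʳ-< N v<u) (trans (ℓ-periodic u v) (trans (ℓ-sym u v) vu))
    ... | k , u<k , k<N+v , uk , kv with fan m {k} (<-trans v<u u<k) (≤-pred k<N+v) vk
        (trans (cong (_+ m) (trans (height-step v<u (<⇒≤ u<k) (<⇒≤ k<N+v) vu vk) (cong (_+ height u) uk)))
               (trans (sym (+-suc (height u) m)) hu))
      where
      vk : ℓ v k ≡ 1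
      vk = trans (ℓ-sym v k) (trans (sym (ℓ-periodic k v)) kv)
    ... | xs , unique , members , length≡m =
      T ∷ xs , (All.tabulate T∉xs ∷ unique) , (λ S → mk⇔ to from) , cong suc length≡m
      where
      T : Subset N
      T = triple (vertex v) (vertex u) (vertex k)
      -- The triangles listed later miss the arc from `v` to `k`, on which `T` has the corner `u`.
      T∉xs : ∀ {S} → S ∈ₗ xs → T ≢ S
      T∉xs {S} S∈xs refl with Equivalence.to (members S) S∈xs
      ... | _ , _ , free = free u v<u u<k (∈-triple⁺ (inj₂ (inj₁ refl)))
      T-free : Free T v u
      T-free t v<t t<u t∈T with ∈-triple⁻ t∈T
      ... | inj₁ t≡v = vertex-≢ v<t (<-trans t<u (<-trans u<k k<N+v)) (sym t≡v)
      ... | inj₂ (inj₁ t≡u) = vertex-≢ t<u (<-trans (<-trans u<k k<N+v) (+-monoʳ-< N v<t)) t≡u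
      ... | inj₂ (inj₂ t≡k) = vertex-≢ (<-trans t<u u<k) (<-trans k<N+v (+-monoʳ-< N v<t)) t≡k
      to : ∀ {S} → S ∈ₗ (T ∷ xs) → Beyond u S
      to (here refl) = triangle-region v<u u<k k<N+v vu uk kv , ∈-triple⁺ (inj₁ refl) , T-free
      to {S} (there S∈xs) with Equivalence.to (members S) S∈xs
      ... | region , v∈S , free = region , v∈S , λ t v<t t<u → free t v<t (<-trans t<u u<k)
      from : ∀ {S} → Beyond u S → S ∈ₗ (T ∷ xs)
      from {S} (region , v∈S , vu-free) with vertex u ∈? S
      ... | yes u∈S = here (Region.≡-triple region v<u u<k k<N+v v∈S u∈S vu-free uk kv)
      ... | no u∉S = there (Equivalence.from (members S) (region , v∈S , vk-free))
        where
        -- The first vertex `w` of `S` after `v` is joined to `v`. If it lay between `u` and `k`,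
        -- the chord `{v, w}` would cross `{u, k}`.
        vk-free : Free S v k
        vk-free t v<t t<k t∈S with least-above (λ t → vertex t ∈? S) v<t t∈S
        ... | w , v<w , w≤t , w∈S , vw-free with <-cmp w u
        ... | tri< w<u _ _ = vu-free w v<w w<u w∈S
        ... | tri≈ _ refl _ = u∉S w∈S
        ... | tri> _ _ u<w = no-crossing v<u u<w w<k k<N+v
            (Region.consecutive region v<w (<-trans w<k k<N+v) v∈S w∈S vw-free) uk
          where
          w<k : w < k
          w<k = ≤-<-trans w≤t t<k

    trianglesAt : TrianglesAt triangulation (vertex v) (+ height last)
    trianglesAt with
      fan (height last) ≤-refl (≤-pred (suc<N+ v)) (ℓ-suc v) (cong (_+ height last) (ℓ-refl (suc v)))
    ... | xs , unique , members , length≡ = _ , (xs , unique , members′ , length≡) , refl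
      where
      members′ : ∀ S → _
      members′ S = mk⇔
        (λ S∈xs → let region , v∈S , _ = Equivalence.to (members S) S∈xs in region , v∈S)
        (λ { (region , v∈S) → Equivalence.from (members S) (region , v∈S , free-suc v) })

-- Friezes from solutions of R = 0

-- The vector wᵢ is (X (i + 1) , Y (i + 1)), so that no negative index occurs and
-- w₋₁ , w₀ is the standard basis.
module Recurrence (s : ℕ → ℤ) where

  solution : ℤ → ℤ → ℕ → ℤ
  solution x y zero          = x
  solution x y (suc zero)    = y
  solution x y (suc (suc i)) = s i ℤ.* solution x y (suc i) - solution x y i

  X Y : ℕ → ℤ
  X = solution 1ℤ 0ℤ
  Y = solution 0ℤ 1ℤ

  -- The determinant of the vectors with indices `i - 1` and `j - 1`, a discrete Wronskian of `X`
  -- and `Y`.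
  Λ : ℕ → ℕ → ℤ
  Λ i j = X i ℤ.* Y j - X j ℤ.* Y i

  Λ-refl : ∀ i → Λ i i ≡ 0ℤ
  Λ-refl i = ℤ.+-inverseʳ (X i ℤ.* Y i)

  Λ-antisym : ∀ i j → Λ j i ≡ - Λ i j
  Λ-antisym i j = identity (X i) (Y i) (X j) (Y j)
    where
    identity : ∀ x y x′ y′ → x′ ℤ.* y - x ℤ.* y′ ≡ - (x ℤ.* y′ - x′ ℤ.* y)
    identity = solve-∀

  Λ-suc : ∀ i → Λ i (suc i) ≡ 1ℤ
  Λ-suc zero    = refl
  Λ-suc (suc i) = trans (identity (s i) (X i) (Y i) (X (suc i)) (Y (suc i))) (Λ-suc i)
    where
    identity : ∀ c x y x′ y′ → x′ ℤ.* (c ℤ.* y′ - y) - (c ℤ.* x′ - x) ℤ.* y′ ≡ x ℤ.* y′ - x′ ℤ.* y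
    identity = solve-∀

  Λ-suc-suc : ∀ i → Λ i (suc (suc i)) ≡ s i
  Λ-suc-suc i = trans (identity (s i) (X i) (Y i) (X (suc i)) (Y (suc i)))
    (trans (cong (s i ℤ.*_) (Λ-suc i)) (ℤ.*-identityʳ (s i)))
    where
    identity : ∀ c x y x′ y′ → x ℤ.* (c ℤ.* y′ - y) - (c ℤ.* x′ - x) ℤ.* y ≡ c ℤ.* (x ℤ.* y′ - x′ ℤ.* y)
    identity = solve-∀

  -- The recurrence is solved for the lower index because `K-recurrence` removes entries from the
  -- front.
  Λ-recurrence : ∀ i j → Λ i j ≡ s i ℤ.* Λ (suc i) j - Λ (suc (suc i)) j
  Λ-recurrence i j = identity (s i) (X i) (Y i) (X (suc i)) (Y (suc i)) (X j) (Y j)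
    where
    identity : ∀ c x y x′ y′ u v →
      x ℤ.* v - u ℤ.* y ≡ c ℤ.* (x′ ℤ.* v - u ℤ.* y′) - ((c ℤ.* x′ - x) ℤ.* v - u ℤ.* (c ℤ.* y′ - y))
    identity = solve-∀

  plücker : ∀ i j k l → Λ i k ℤ.* Λ j l ≡ Λ i j ℤ.* Λ k l ℤ.+ Λ i l ℤ.* Λ j k
  plücker i j k l = identity (X i) (Y i) (X j) (Y j) (X k) (Y k) (X l) (Y l)
    where
    identity : ∀ a b c d e f g h →
      (a ℤ.* f - e ℤ.* b) ℤ.* (c ℤ.* h - g ℤ.* d) ≡
      (a ℤ.* d - c ℤ.* b) ℤ.* (e ℤ.* h - g ℤ.* f) ℤ.+ (a ℤ.* h - g ℤ.* b) ℤ.* (c ℤ.* f - e ℤ.* d)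
    identity = solve-∀

  -- Both sides satisfy the same recurrence in the first index. The end `j` is tied to `i` only by
  -- an equation, so it can stay fixed while entries are dropped from the front.
  continuant : ∀ m {i j} (f : Vector ℤ m) → (∀ k → f k ≡ s (i + toℕ k)) →
    j ≡ suc m + i → Λ i j ≡ K f
  continuant zero {i} f f≗s refl = Λ-suc i
  continuant (suc zero) {i} f f≗s refl = trans (Λ-suc-suc i)
    (trans (cong s (sym (+-identityʳ i))) (trans (sym (f≗s zero)) (identity (f zero))))
    where
    identity : ∀ x → x ≡ 1ℤ ℤ.* x ℤ.* 1ℤ ℤ.+ 0ℤ
    identity = solve-∀
  continuant (suc (suc m)) {i} {j} f f≗s j≡ = begin
    Λ i j
      ≡⟨ Λ-recurrence i j ⟩
    s i ℤ.* Λ (suc i) j - Λ (suc (suc i)) j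
      ≡⟨ cong₂ (λ u v → s i ℤ.* u - v)
      (continuant (suc m) (tail f)
        (λ k → trans (f≗s (suc k)) (cong s (+-suc i (toℕ k))))
        (trans j≡ (sym (+-suc (suc (suc m)) i))))
      (continuant m (tail (tail f))
        (λ k → trans (f≗s (suc (suc k)))
          (cong s (trans (+-suc i (suc (toℕ k))) (cong suc (+-suc i (toℕ k))))))
        (trans j≡ (sym (trans (+-suc (suc m) (suc i)) (cong suc (+-suc (suc m) i)))))) ⟩
    s i ℤ.* K (tail f) - K (tail (tail f))
      ≡⟨ cong (λ c → c ℤ.* K (tail f) - K (tail (tail f)))
           (trans (f≗s zero) (cong s (+-identityʳ i))) ⟨
    f zero ℤ.* K (tail f) - K (tail (tail f))
      ≡⟨ K-recurrence f ⟨
    K f ∎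
    where open ≡-Reasoning

  -- The shift by a period of the coefficients

  module Antiperiodic (n : ℕ) (s-periodic : ∀ i → s (n + i) ≡ s i) (trace-zero : Λ 0 (suc n) ≡ Λ 1 n) where

    -- By periodicity of `s`, the shifted sequence solves the same recurrence in `i`, so it is the
    -- combination of `X` and `Y` with its own initial values.
    shift : ∀ x y i → let Z = solution x y in Z (n + i) ≡ X i ℤ.* Z n ℤ.+ Y i ℤ.* Z (suc n)
    shift x y zero = trans (cong (solution x y) (+-identityʳ n))
      (identity (solution x y n) (solution x y (suc n)))
      where
      identity : ∀ z z′ → z ≡ 1ℤ ℤ.* z ℤ.+ 0ℤ ℤ.* z′
      identity = solve-∀
    shift x y (suc zero) = trans (cong (solution x y) (+-comm n 1))
      (identity (solution x y n) (solution x y (suc n)))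
      where
      identity : ∀ z z′ → z′ ≡ 0ℤ ℤ.* z ℤ.+ 1ℤ ℤ.* z′
      identity = solve-∀
    shift x y (suc (suc i)) = begin
      Z (n + suc (suc i))
        ≡⟨ cong Z (trans (+-suc n (suc i)) (cong suc (+-suc n i))) ⟩
      s (n + i) ℤ.* Z (suc (n + i)) - Z (n + i)
        ≡⟨ cong₂ (λ c k → c ℤ.* Z k - Z (n + i)) (s-periodic i) (sym (+-suc n i)) ⟩
      s i ℤ.* Z (n + suc i) - Z (n + i)
        ≡⟨ cong₂ (λ u v → s i ℤ.* u - v) (shift x y (suc i)) (shift x y i) ⟩
      s i ℤ.* (X (suc i) ℤ.* Z n ℤ.+ Y (suc i) ℤ.* Z (suc n)) - (X i ℤ.* Z n ℤ.+ Y i ℤ.* Z (suc n))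
        ≡⟨ identity (s i) (X i) (Y i) (X (suc i)) (Y (suc i)) (Z n) (Z (suc n)) ⟩
      X (suc (suc i)) ℤ.* Z n ℤ.+ Y (suc (suc i)) ℤ.* Z (suc n) ∎
      where
      open ≡-Reasoning
      Z = solution x y
      identity : ∀ c p q p′ q′ z z′ →
        c ℤ.* (p′ ℤ.* z ℤ.+ q′ ℤ.* z′) - (p ℤ.* z ℤ.+ q ℤ.* z′) ≡ (c ℤ.* p′ - p) ℤ.* z ℤ.+ (c ℤ.* q′ - q) ℤ.* z′
      identity = solve-∀

    -- The shift acts on the vectors as a matrix of determinant `Λ n (suc n) = 1`.
    Λ-shift : ∀ i j → Λ (n + i) (n + j) ≡ Λ i j
    Λ-shift i j = begin
      Λ (n + i) (n + j)
        ≡⟨ cong₂ _-_ (cong₂ ℤ._*_ (shift 1ℤ 0ℤ i) (shift 0ℤ 1ℤ j)) (cong₂ ℤ._*_ (shift 1ℤ 0ℤ j) (shift 0ℤ 1ℤ i)) ⟩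
      _ ≡⟨ identity (X i) (Y i) (X j) (Y j) (X n) (Y n) (X (suc n)) (Y (suc n)) ⟩
      Λ n (suc n) ℤ.* Λ i j ≡⟨ cong (ℤ._* Λ i j) (Λ-suc n) ⟩
      1ℤ ℤ.* Λ i j ≡⟨ ℤ.*-identityˡ (Λ i j) ⟩
      Λ i j ∎
      where
      open ≡-Reasoning
      identity : ∀ a b c d x y x′ y′ →
        (a ℤ.* x ℤ.+ b ℤ.* x′) ℤ.* (c ℤ.* y ℤ.+ d ℤ.* y′) - (c ℤ.* x ℤ.+ d ℤ.* x′) ℤ.* (a ℤ.* y ℤ.+ b ℤ.* y′) ≡
        (x ℤ.* y′ - x′ ℤ.* y) ℤ.* (a ℤ.* d - c ℤ.* b)
      identity = solve-∀

    -- The initial values turn the two sides of `trace-zero` into `Y (suc n)` and `- X n`, the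
    -- diagonal entries of the shift matrix up to sign.
    Y-suc-n : Y (suc n) ≡ - X n
    Y-suc-n = trans (identity₁ (Y (suc n)) (X (suc n))) (trans trace-zero (identity₂ (Y n) (X n)))
      where
      identity₁ : ∀ y x → y ≡ 1ℤ ℤ.* y - x ℤ.* 0ℤ
      identity₁ = solve-∀
      identity₂ : ∀ y x → 0ℤ ℤ.* y - x ℤ.* 1ℤ ≡ - x
      identity₂ = solve-∀

    determinant : X n ℤ.* - X n - X (suc n) ℤ.* Y n ≡ 1ℤ
    determinant = trans (cong (λ y → X n ℤ.* y - X (suc n) ℤ.* Y n) (sym Y-suc-n)) (Λ-suc n)

    -- The shift by n has trace 0 and determinant 1, so its square is −1 by Cayley–Hamilton.
    X-antiperiodic : ∀ i → X (n + n + i) ≡ - X i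
    X-antiperiodic i = begin
      X (n + n + i)                                 ≡⟨ cong X (+-assoc n n i) ⟩
      X (n + (n + i))                               ≡⟨ shift 1ℤ 0ℤ (n + i) ⟩
      X (n + i) ℤ.* X n ℤ.+ Y (n + i) ℤ.* X (suc n)
        ≡⟨ cong₂ (λ u v → u ℤ.* X n ℤ.+ v ℤ.* X (suc n)) (shift 1ℤ 0ℤ i)
             (trans (shift 0ℤ 1ℤ i) (cong (λ y → X i ℤ.* Y n ℤ.+ Y i ℤ.* y) Y-suc-n)) ⟩
      _                                                 ≡⟨ identity (X i) (Y i) (X n) (Y n) (X (suc n)) ⟩
      - X i ℤ.* (X n ℤ.* - X n - X (suc n) ℤ.* Y n)           ≡⟨ cong (- X i ℤ.*_) determinant ⟩
      - X i ℤ.* 1ℤ                                        ≡⟨ ℤ.*-identityʳ (- X i) ⟩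
      - X i                                             ∎
      where
      open ≡-Reasoning
      identity : ∀ p q x y x′ →
        (p ℤ.* x ℤ.+ q ℤ.* x′) ℤ.* x ℤ.+ (p ℤ.* y ℤ.+ q ℤ.* - x) ℤ.* x′ ≡ - p ℤ.* (x ℤ.* - x - x′ ℤ.* y)
      identity = solve-∀

    Y-antiperiodic : ∀ i → Y (n + n + i) ≡ - Y i
    Y-antiperiodic i = begin
      Y (n + n + i)                                 ≡⟨ cong Y (+-assoc n n i) ⟩
      Y (n + (n + i))                               ≡⟨ shift 0ℤ 1ℤ (n + i) ⟩
      X (n + i) ℤ.* Y n ℤ.+ Y (n + i) ℤ.* Y (suc n)
        ≡⟨ cong₂ (λ u v → u ℤ.* Y n ℤ.+ v ℤ.* Y (suc n)) (shift 1ℤ 0ℤ i) (shift 0ℤ 1ℤ i) ⟩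
      _ ≡⟨ cong (λ y → (X i ℤ.* X n ℤ.+ Y i ℤ.* X (suc n)) ℤ.* Y n ℤ.+ (X i ℤ.* Y n ℤ.+ Y i ℤ.* y) ℤ.* y)
             Y-suc-n ⟩
      _                                                 ≡⟨ identity (X i) (Y i) (X n) (Y n) (X (suc n)) ⟩
      - Y i ℤ.* (X n ℤ.* - X n - X (suc n) ℤ.* Y n)           ≡⟨ cong (- Y i ℤ.*_) determinant ⟩
      - Y i ℤ.* 1ℤ                                        ≡⟨ ℤ.*-identityʳ (- Y i) ⟩
      - Y i                                             ∎
      where
      open ≡-Reasoning
      identity : ∀ p q x y x′ →
        (p ℤ.* x ℤ.+ q ℤ.* x′) ℤ.* y ℤ.+ (p ℤ.* y ℤ.+ q ℤ.* - x) ℤ.* - x ≡ - q ℤ.* (x ℤ.* - x - x′ ℤ.* y)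
      identity = solve-∀

    Λ-antiperiodic : ∀ i j → Λ i (n + n + j) ≡ - Λ i j
    Λ-antiperiodic i j = trans
      (cong₂ (λ u v → X i ℤ.* u - v ℤ.* Y i) (Y-antiperiodic j) (X-antiperiodic j))
      (identity (X i) (Y i) (X j) (Y j))
      where
      identity : ∀ x y x′ y′ → x ℤ.* - y′ - - x′ ℤ.* y ≡ - (x ℤ.* y′ - x′ ℤ.* y)
      identity = solve-∀

    module _ (short-positive : ∀ d i → d ≤ n → 0ℤ ℤ.< Λ i (suc d + i)) where

      -- Antiperiodicity and antisymmetry give `Λ i j = Λ j (n + n + i)`, so it suffices that one of
      -- the two complementary arcs is short. They cannot both be long, as `d + d′ + 2 = n + n`.
      Λ-positive : ∀ {i j} → i < j → j < n + n + i → 0ℤ ℤ.< Λ i j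
      Λ-positive {i} {j} i<j j<N+i with m≤n⇒∃[o]m+o≡n i<j | m≤n⇒∃[o]m+o≡n j<N+i
      ... | d , si+d≡j | d′ , sj+d′≡N+i with d ≤? n | d′ ≤? n
      ... | yes d≤n | _ = subst (λ j → 0ℤ ℤ.< Λ i j)
        (trans (cong suc (+-comm d i)) si+d≡j) (short-positive d i d≤n)
      ... | no _ | yes d′≤n = subst (0ℤ ℤ.<_) reflect
        (subst (λ k → 0ℤ ℤ.< Λ j k) (trans (cong suc (+-comm d′ j)) sj+d′≡N+i) (short-positive d′ j d′≤n))
        where
        reflect : Λ j (n + n + i) ≡ Λ i j
        reflect = trans (Λ-antiperiodic j i) (sym (Λ-antisym j i))
      ... | no d≰n | no d′≰n = contradiction (begin-strict
        n + n + i     ≡⟨ +-comm (n + n) i ⟩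
        i + (n + n)   <⟨ +-monoʳ-< i (+-mono-< (≰⇒> d≰n) (≰⇒> d′≰n)) ⟩
        i + (d + d′)  ≡⟨ +-assoc i d d′ ⟨
        i + d + d′    ≤⟨ +-monoˡ-≤ d′ (≤-trans (n≤1+n (i + d))
                               (≤-trans (≤-reflexive si+d≡j) (n≤1+n j))) ⟩
        suc j + d′      ≡⟨ sj+d′≡N+i ⟩
        n + n + i     ∎) (<-irrefl refl)
        where open ≤-Reasoning

  trace-zero : ∀ {m} (a : Vector ℤ (suc m)) → (∀ k → a k ≡ s (toℕ k)) → R a ≡ 0ℤ →
    Λ 0 (suc (suc m)) ≡ Λ 1 (suc m)
  trace-zero {m} a a≗s Ra≡0 = trans
    (continuant (suc m) a a≗s (cong (λ t → suc (suc t)) (sym (+-identityʳ m))))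
    (K≡Λ a a≗s Ra≡0)
    where
    K≡Λ : ∀ {m} (a : Vector ℤ (suc m)) → (∀ k → a k ≡ s (toℕ k)) → R a ≡ 0ℤ → K a ≡ Λ 1 (suc m)
    -- For `n = 1` the convention that the continuant with index -1 is 0 agrees with `Λ 1 1`, which
    -- computes to 0.
    K≡Λ {zero} a a≗s Ra≡0 = ℤ.i-j≡0⇒i≡j _ _ Ra≡0
    K≡Λ {suc m} a a≗s Ra≡0 = trans (ℤ.i-j≡0⇒i≡j _ _ Ra≡0)
      (sym (continuant m _
        (λ k → trans (a≗s (suc (inject₁ k))) (cong (s ∘ suc) (toℕ-inject₁ k)))
        (cong suc (+-comm 1 m))))

-- Replacing `x` by the join of its split reduces to the two halves; on the second, adding `n` once
-- more completes a full turn.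
antipode-vertex : ∀ n′ (x : Fin (suc n′ + suc n′)) →
  antipode {suc n′} x ≡ Polygon.vertex (n′ + suc n′) (suc n′ + toℕ x)
antipode-vertex n′ x = subst
  (λ y → antipode {n} x ≡ vertex (n + toℕ y)) (join-splitAt n n x) (opposite (splitAt n x))
  where
  open Polygon (n′ + suc n′)
  n = suc n′
  opposite : ∀ y → join n n (swap y) ≡ vertex (n + toℕ (join n n y))
  opposite (inj₁ i) = trans (sym (vertex-toℕ (n ↑ʳ i)))
    (cong vertex (trans (toℕ-↑ʳ n i) (cong (λ t → n + t) (sym (toℕ-↑ˡ i n)))))
  opposite (inj₂ j) = begin
    j ↑ˡ n                             ≡⟨ vertex-toℕ (j ↑ˡ n) ⟨
    vertex (toℕ (j ↑ˡ n))              ≡⟨ cong vertex (toℕ-↑ˡ j n) ⟩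
    vertex (toℕ j)                     ≡⟨ vertex-N+ (toℕ j) ⟨
    vertex (n + n + toℕ j)         ≡⟨ cong vertex (+-assoc n n (toℕ j)) ⟩
    vertex (n + (n + toℕ j))       ≡⟨ cong (λ t → vertex (n + t)) (toℕ-↑ʳ n j) ⟨
    vertex (n + toℕ (n ↑ʳ j))        ∎
    where open ≡-Reasoning

-- The frieze of a totally positive solution

module Solution {n′ : ℕ} (a : Vector ℤ (suc n′))
  (Ra≡0 : R a ≡ 0ℤ) (positive : TotallyPositive a) where

  n : ℕ
  n = suc n′

  N′ : ℕ
  N′ = n′ + n

  open Polygon N′ using (N; vertex; vertex-N+; vertex-toℕ)

  s : ℕ → ℤ
  s i = periodic a (+ i)

  s-cong : ∀ i x → i % n ≡ toℕ x → s i ≡ a x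
  s-cong i x eq = cong a (toℕ-injective (trans (toℕ-fromℕ< (n%ℕd<d (+ i) n)) eq))

  s-toℕ : ∀ x → s (toℕ x) ≡ a x
  s-toℕ x = s-cong (toℕ x) x (m<n⇒m%n≡m (toℕ<n x))

  s-periodic : ∀ i → s (n + i) ≡ s i
  s-periodic i = s-cong (n + i) _ (trans (cong (_% n) (+-comm n i))
    (trans ([m+n]%n≡m%n i n) (sym (toℕ-fromℕ< (n%ℕd<d (+ i) n)))))

  open Recurrence s
  open Antiperiodic n s-periodic (trace-zero a (sym ∘ s-toℕ) Ra≡0)

  short-positive : ∀ d i → d ≤ n → 0ℤ ℤ.< Λ i (suc d + i)
  short-positive zero i _ = subst (0ℤ ℤ.<_) (sym (Λ-suc i)) (ℤ.+<+ z<s)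
  -- Index distance `m + 2` corresponds to a continuant of `m + 1` entries, those at positions `i`
  -- to `i + m`.
  short-positive (suc m) i m<n = subst (0ℤ ℤ.<_)
    (sym (continuant _ (segment (periodic a) (+ i) (+ (i + m))) (λ _ → refl)
      (cong (λ z → suc (suc ℤ.∣ z ∣) + i) (sym difference))))
    (positive (+ i) (+ (i + m)) (ℤ.+≤+ (m≤m+n i m))
      (subst (ℤ._≤ + n) (sym difference) (ℤ.+≤+ (<⇒≤ m<n))))
    where
    difference : ℤ.+ (i + m) - + i ≡ + m
    difference = trans (ℤ.m-n≡m⊖n (i + m) i)
      (trans (ℤ.⊖-≥ (m≤m+n i m)) (cong +_ (m+n∸m≡n i m)))

  -- The successors undo the index shift in `X` and `Y`, which places the coefficient `s v` at
  -- vertex `v`. The absolute value turns antisymmetry into symmetry and antiperiodicity into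
  -- periodicity.
  ℓ : ℕ → ℕ → ℕ
  ℓ i j = ℤ.∣ Λ (suc i) (suc j) ∣

  Λ-positive′ : ∀ {i j} → i < j → j < N + i → 0ℤ ℤ.< Λ (suc i) (suc j)
  Λ-positive′ {i} {j} i<j j<N+i = Λ-positive short-positive (s≤s i<j)
    (subst (suc j <_) (sym (+-suc N i)) (s≤s j<N+i))

  -- The determinant is positive inside this window and 0 at its ends. Hence the Plücker relation
  -- over ℤ can be read as `ptolemy` over ℕ.
  +ℓ : ∀ {i j} → i ≤ j → j ≤ N + i → + ℓ i j ≡ Λ (suc i) (suc j)
  +ℓ {i} {j} i≤j j≤N+i = ℤ.0≤i⇒+∣i∣≡i nonNegative
    where
    nonNegative : 0ℤ ℤ.≤ Λ (suc i) (suc j)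
    nonNegative with m≤n⇒m<n∨m≡n i≤j | m≤n⇒m<n∨m≡n j≤N+i
    ... | inj₂ refl | _ = ℤ.≤-reflexive (sym (Λ-refl (suc i)))
    ... | inj₁ i<j | inj₁ j<N+i = ℤ.<⇒≤ (Λ-positive′ i<j j<N+i)
    ... | inj₁ _ | inj₂ refl = ℤ.≤-reflexive (sym (trans
      (cong (Λ (suc i)) (sym (+-suc N i)))
      (trans (Λ-antiperiodic (suc i) (suc i)) (cong -_ (Λ-refl (suc i))))))

  frieze : Frieze N′
  frieze = record
    { ℓ          = ℓ
    ; ℓ-refl     = λ i → cong ℤ.∣_∣ (Λ-refl (suc i))
    ; ℓ-sym      = λ i j → trans (cong ℤ.∣_∣ (Λ-antisym (suc j) (suc i))) (ℤ.∣-i∣≡∣i∣ (Λ (suc j) (suc i)))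
    ; ℓ-suc      = λ i → cong ℤ.∣_∣ (Λ-suc (suc i))
    ; ℓ-periodic = λ i j → trans (cong (ℤ.∣_∣ ∘ Λ (suc i)) (sym (+-suc N j)))
        (trans (cong ℤ.∣_∣ (Λ-antiperiodic (suc i) (suc j))) (ℤ.∣-i∣≡∣i∣ (Λ (suc i) (suc j))))
    ; ℓ-positive = λ i<j j<N+i → ℤ.drop‿+<+
        (subst (0ℤ ℤ.<_) (sym (+ℓ (<⇒≤ i<j) (<⇒≤ j<N+i))) (Λ-positive′ i<j j<N+i))
    ; ptolemy    = ptolemy
    }
    where
    ptolemy : ∀ {i j k l} → i ≤ j → j ≤ k → k ≤ l → l ≤ N + i →
      ℓ i k * ℓ j l ≡ ℓ i j * ℓ k l + ℓ i l * ℓ j k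
    ptolemy {i} {j} {k} {l} i≤j j≤k k≤l l≤N+i = ℤ.+-injective (begin
      + (ℓ i k * ℓ j l)                               ≡⟨ ℤ.pos-* (ℓ i k) (ℓ j l) ⟩
      + ℓ i k ℤ.* + ℓ j l
        ≡⟨ cong₂ ℤ._*_ (+ℓ (≤-trans i≤j j≤k) (≤-trans k≤l l≤N+i)) (+ℓ (≤-trans j≤k k≤l) l≤N+j) ⟩
      Λ (suc i) (suc k) ℤ.* Λ (suc j) (suc l)             ≡⟨ plücker (suc i) (suc j) (suc k) (suc l) ⟩
      Λ (suc i) (suc j) ℤ.* Λ (suc k) (suc l) ℤ.+ Λ (suc i) (suc l) ℤ.* Λ (suc j) (suc k)
        ≡⟨ cong₂ ℤ._+_
             (cong₂ ℤ._*_ (+ℓ i≤j (≤-trans (≤-trans j≤k k≤l) l≤N+i))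
                        (+ℓ k≤l (≤-trans l≤N+j (+-monoʳ-≤ N j≤k))))
             (cong₂ ℤ._*_ (+ℓ (≤-trans i≤j (≤-trans j≤k k≤l)) l≤N+i) (+ℓ j≤k (≤-trans k≤l l≤N+j))) ⟨
      + ℓ i j ℤ.* + ℓ k l ℤ.+ + ℓ i l ℤ.* + ℓ j k
        ≡⟨ cong₂ ℤ._+_ (ℤ.pos-* (ℓ i j) (ℓ k l)) (ℤ.pos-* (ℓ i l) (ℓ j k)) ⟨
      + (ℓ i j * ℓ k l) ℤ.+ + (ℓ i l * ℓ j k)         ≡⟨ ℤ.pos-+ (ℓ i j * ℓ k l) (ℓ i l * ℓ j k) ⟨
      + (ℓ i j * ℓ k l + ℓ i l * ℓ j k)           ∎)
      where
      open ≡-Reasoning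
      l≤N+j : l ≤ N + j
      l≤N+j = ≤-trans l≤N+i (+-monoʳ-≤ N i≤j)

  open Dissection frieze using (D; triangulation; D-rotate⇔; module Fan)

  centrallySymmetric : CentrallySymmetric {n} triangulation
  centrallySymmetric x y = subst₂ (λ u v → D x y ⇔ D u v)
    (sym (antipode-vertex n′ x)) (sym (antipode-vertex n′ y))
    (D-rotate⇔ n ℓ-rotate vertex-n+n+ x y)
    where
    ℓ-rotate : ∀ i j → ℓ (n + i) (n + j) ≡ ℓ i j
    ℓ-rotate i j = cong ℤ.∣_∣ (trans (sym (cong₂ Λ (+-suc n i) (+-suc n j))) (Λ-shift (suc i) (suc j)))
    vertex-n+n+ : ∀ i → vertex (n + (n + i)) ≡ vertex i
    vertex-n+n+ i = trans (cong vertex (sym (+-assoc n n i))) (vertex-N+ i)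

  trianglesAt : ∀ x → TrianglesAt triangulation x (s (toℕ x))
  trianglesAt x = subst₂ (TrianglesAt triangulation) (vertex-toℕ x) height-last (Fan.trianglesAt v)
    where
    v = toℕ x
    open ≡-Reasoning
    -- Antiperiodicity brings `N + v` back to `v`; what remains is the minor of the two neighbours
    -- of vertex `v`, which is its coefficient.
    height-last : ℤ.+ ℓ (suc v) (N′ + v) ≡ s v
    height-last = begin
      + ℤ.∣ Λ (suc (suc v)) (N + v) ∣   ≡⟨ cong (λ z → + ℤ.∣ z ∣) (Λ-antiperiodic (suc (suc v)) v) ⟩
      + ℤ.∣ - Λ (suc (suc v)) v ∣         ≡⟨ cong (λ z → + ℤ.∣ z ∣) (Λ-antisym (suc (suc v)) v) ⟨
      + ℤ.∣ Λ v (suc (suc v)) ∣           ≡⟨ ℤ.0≤i⇒+∣i∣≡i (ℤ.<⇒≤ (short-positive 1 v (s≤s z≤n))) ⟩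
      Λ v (suc (suc v))                 ≡⟨ Λ-suc-suc v ⟩
      s v                               ∎

theorem2 : (n : ℕ) .{{_ : NonZero n}} (a : Vector ℤ n) →
    R a ≡ 0ℤ → TotallyPositive a →
    Σ[ 𝒯 ∈ Triangulation (n + n) ]
    (CentrallySymmetric {n} 𝒯 ×
    (∀ (i : Fin n) → TrianglesAt 𝒯 (i ↑ˡ n) (a i) × TrianglesAt 𝒯 (n ↑ʳ i) (a i)))
theorem2 n@(suc _) a Ra≡0 positive = 𝒯 , centrallySymmetric , λ i →
  subst (TrianglesAt 𝒯 _) (trans (cong s (toℕ-↑ˡ i n)) (s-toℕ i)) (trianglesAt (i ↑ˡ n)) ,
  subst (TrianglesAt 𝒯 _) (trans (cong s (toℕ-↑ʳ n i)) (trans (s-periodic (toℕ i)) (s-toℕ i)))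
    (trianglesAt (n ↑ʳ i))
  where
  open Solution a Ra≡0 positive
    using (s; s-toℕ; s-periodic; frieze; centrallySymmetric; trianglesAt)
  𝒯 = Dissection.triangulation frieze
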